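{- The inclusion functor $i:{}^{\mathrm{HCMV}}\mathrm{Top}\to{}^{\mathrm{MV}}\mathrm{Top}$, from the category of compact Hausdorff MV-topological spaces into the category of all MV-topological spaces, has a left adjoint.
   Context: On $[0,1]$ put $x\oplus y=\min(x+y,1)$, $x\odot y=\max(x+y-1,0)$, $x\wedge y=\min(x,y)$; these operations and arbitrary joins are extended pointwise to $[0,1]^X$. $\mathbf 0,\mathbf 1$ denote the constant functions $0,1$. An MV-topological space is a pair $\langle X,\tau\rangle$ with $\tau\subseteq[0,1]^X$, $\mathbf 0,\mathbf 1\in\tau$, $\tau$ closed under arbitrary joins and under the binary operations $\odot,\oplus,\wedge$. A map $f:\langle X,\tau_X\rangle\to\langle Y,\tau_Y\rangle$ is continuous if $\alpha\circ f\in\tau_X$ for every $\alpha\in\tau_Y$. ${}^{\mathrm{MV}}\mathrm{Top}$ is the category of MV-topological spaces and continuous maps. $\langle X,\tau\rangle$ is compact if for every $\Gamma\subseteq\tau$ with $\bigvee\Gamma=\mathbf 1$ there is a finite family $(\alpha_k)_{k=1}^n$ of elements of $\Gamma$ (repetitions allowed) with $\alpha_1\oplus\cdots\oplus\alpha_n=\mathbf 1$. It is Hausdorff if for all $x\neq y$ in $X$ there are $o_x,o_y\in\tau$ with $o_x(x)=o_y(y)=1$ and $o_x\wedge o_y=\mathbf 0$. ${}^{\mathrm{HCMV}}\mathrm{Top}$ is the full subcategory of ${}^{\mathrm{MV}}\mathrm{Top}$ whose objects are the compact Hausdorff MV-spaces. -}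

module Defs where

open import Level using (Level; 0ℓ; suc; _⊔_)
open import Data.List.Base using (List; foldr)
open import Data.List.Relation.Unary.All using (All)
open import Data.Nat.Base as ℕ using (ℕ)
import Data.Nat.Properties as ℕ
open import Data.Product.Base using (Σ; ∃-syntax; _×_; _,_; proj₁; proj₂)
open import Data.Rational.Base as ℚ using (ℚ; 0ℚ; 1ℚ; ½)
import Data.Rational.Properties as ℚ
open import Function.Base using (_∘_; id)
open import Relation.Binary.PropositionalEquality
  using (_≡_; _≢_; _≗_; refl; sym; trans; cong; subst; subst₂)
open import Relation.Binary.Structures using (IsEquivalence)
open import Relation.Unary using (Pred; _⊆_)

------------------------------------------------------------------------
-- Real numbers as Cauchy sequences of rationals, considered up to _≈ℝ_

Eventually : Pred ℕ 0ℓ → Set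
Eventually P = ∃[ N ] (∀ n → N ℕ.≤ n → P n)

-- m and n range over the same tail, so the bound is on ∣ f m - f n ∣.
IsCauchy : (ℕ → ℚ) → Set
IsCauchy f = ∀ ε → 0ℚ ℚ.< ε →
  ∃[ N ] (∀ m n → N ℕ.≤ m → N ℕ.≤ n → f m ℚ.≤ f n ℚ.+ ε)

record ℝ : Set where
  constructor mkℝ
  field
    seq    : ℕ → ℚ
    cauchy : IsCauchy seq
open ℝ public

infix 4 _≤ℝ_ _≈ℝ_

_≤ℝ_ : ℝ → ℝ → Set
x ≤ℝ y = ∀ ε → 0ℚ ℚ.< ε → Eventually (λ n → seq x n ℚ.≤ seq y n ℚ.+ ε)

_≈ℝ_ : ℝ → ℝ → Set
x ≈ℝ y = x ≤ℝ y × y ≤ℝ x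

p≤p+ε : ∀ p {ε} → 0ℚ ℚ.< ε → p ℚ.≤ p ℚ.+ ε
p≤p+ε p {ε} 0<ε =
  subst (ℚ._≤ p ℚ.+ ε) (ℚ.+-identityʳ p) (ℚ.+-monoʳ-≤ p (ℚ.<⇒≤ 0<ε))

private
  half : ℚ → ℚ
  half ε = ½ ℚ.* ε

  half-pos : ∀ {ε} → 0ℚ ℚ.< ε → 0ℚ ℚ.< half ε
  half-pos {ε} 0<ε =
    subst (ℚ._< half ε) (ℚ.*-zeroʳ ½) (ℚ.*-monoʳ-<-pos ½ 0<ε)

  half+half : ∀ ε → half ε ℚ.+ half ε ≡ ε
  half+half ε = trans (sym (ℚ.*-distribʳ-+ ε ½ ½)) (ℚ.*-identityˡ ε)

  interchange : ∀ p q r s →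
    (p ℚ.+ r) ℚ.+ (q ℚ.+ s) ≡ (p ℚ.+ q) ℚ.+ (r ℚ.+ s)
  interchange p q r s = trans (ℚ.+-assoc p r (q ℚ.+ s))
    (trans (cong (p ℚ.+_) (trans (sym (ℚ.+-assoc r q s))
      (trans (cong (ℚ._+ s) (ℚ.+-comm r q)) (ℚ.+-assoc q r s))))
      (sym (ℚ.+-assoc p q (r ℚ.+ s))))

  common : {P Q : ℕ → ℕ → Set} →
    ∃[ N ] (∀ m n → N ℕ.≤ m → N ℕ.≤ n → P m n) →
    ∃[ N ] (∀ m n → N ℕ.≤ m → N ℕ.≤ n → Q m n) →
    ∃[ N ] (∀ m n → N ℕ.≤ m → N ℕ.≤ n → P m n × Q m n)
  common (M , p) (N , q) = M ℕ.⊔ N , λ m n M⊔N≤m M⊔N≤n →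
    p m n (ℕ.m⊔n≤o⇒m≤o M N M⊔N≤m) (ℕ.m⊔n≤o⇒m≤o M N M⊔N≤n) ,
    q m n (ℕ.m⊔n≤o⇒n≤o M N M⊔N≤m) (ℕ.m⊔n≤o⇒n≤o M N M⊔N≤n)

-- The proof components of the operations are abstract: only the sequences
-- need to compute.
abstract
  const-cauchy : ∀ q → IsCauchy (λ _ → q)
  const-cauchy q ε 0<ε = 0 , λ _ _ _ _ → p≤p+ε q 0<ε

  +-cauchy : ∀ {f g} → IsCauchy f → IsCauchy g → IsCauchy (λ n → f n ℚ.+ g n)
  +-cauchy {f} {g} cf cg ε 0<ε =
    let (N , h) = common (cf (half ε) (half-pos 0<ε)) (cg (half ε) (half-pos 0<ε))
    in N , λ m n N≤m N≤n →
      subst (f m ℚ.+ g m ℚ.≤_)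
        (trans (interchange (f n) (g n) (half ε) (half ε))
               (cong (f n ℚ.+ g n ℚ.+_) (half+half ε)))
        (ℚ.+-mono-≤ (proj₁ (h m n N≤m N≤n)) (proj₂ (h m n N≤m N≤n)))

  neg-cauchy : ∀ {f} → IsCauchy f → IsCauchy (λ n → ℚ.- f n)
  neg-cauchy {f} cf ε 0<ε =
    let (N , h) = cf ε 0<ε
    in N , λ m n N≤m N≤n →
      subst₂ ℚ._≤_
        (trans (cong (ℚ._+ ε) (ℚ.neg-distrib-+ (f m) ε))
          (trans (ℚ.+-assoc (ℚ.- f m) (ℚ.- ε) ε)
            (trans (cong (ℚ.- f m ℚ.+_) (ℚ.+-inverseˡ ε))
                   (ℚ.+-identityʳ (ℚ.- f m)))))
        refl
        (ℚ.+-monoˡ-≤ ε (ℚ.neg-antimono-≤ (h n m N≤n N≤m)))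

  ⊓-cauchy : ∀ {f g} → IsCauchy f → IsCauchy g → IsCauchy (λ n → f n ℚ.⊓ g n)
  ⊓-cauchy {f} {g} cf cg ε 0<ε =
    let (N , h) = common (cf ε 0<ε) (cg ε 0<ε)
    in N , λ m n N≤m N≤n →
      subst (f m ℚ.⊓ g m ℚ.≤_)
        (sym (ℚ.mono-≤-distrib-⊓ (ℚ.+-monoˡ-≤ ε) (f n) (g n)))
        (ℚ.⊓-mono-≤ (proj₁ (h m n N≤m N≤n)) (proj₂ (h m n N≤m N≤n)))

  ⊔-cauchy : ∀ {f g} → IsCauchy f → IsCauchy g → IsCauchy (λ n → f n ℚ.⊔ g n)
  ⊔-cauchy {f} {g} cf cg ε 0<ε =
    let (N , h) = common (cf ε 0<ε) (cg ε 0<ε)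
    in N , λ m n N≤m N≤n →
      subst (f m ℚ.⊔ g m ℚ.≤_)
        (sym (ℚ.mono-≤-distrib-⊔ (ℚ.+-monoˡ-≤ ε) (f n) (g n)))
        (ℚ.⊔-mono-≤ (proj₁ (h m n N≤m N≤n)) (proj₂ (h m n N≤m N≤n)))

fromℚ : ℚ → ℝ
fromℚ q = mkℝ (λ _ → q) (const-cauchy q)

0ℝ 1ℝ : ℝ
0ℝ = fromℚ 0ℚ
1ℝ = fromℚ 1ℚ

infixl 6 _+ℝ_ _-ℝ_
infixl 7 _⊓ℝ_
infixl 6 _⊔ℝ_
infix  8 -ℝ_

_+ℝ_ : ℝ → ℝ → ℝ
x +ℝ y = mkℝ (λ n → seq x n ℚ.+ seq y n) (+-cauchy (cauchy x) (cauchy y))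

-ℝ_ : ℝ → ℝ
-ℝ x = mkℝ (λ n → ℚ.- seq x n) (neg-cauchy (cauchy x))

_-ℝ_ : ℝ → ℝ → ℝ
x -ℝ y = x +ℝ (-ℝ y)

_⊓ℝ_ : ℝ → ℝ → ℝ
x ⊓ℝ y = mkℝ (λ n → seq x n ℚ.⊓ seq y n) (⊓-cauchy (cauchy x) (cauchy y))

_⊔ℝ_ : ℝ → ℝ → ℝ
x ⊔ℝ y = mkℝ (λ n → seq x n ℚ.⊔ seq y n) (⊔-cauchy (cauchy x) (cauchy y))

------------------------------------------------------------------------
-- The unit interval and its MV-operations

record 𝕀 : Set where
  constructor mk𝕀
  field
    val : ℝ
    0≤  : 0ℝ ≤ℝ val
    ≤1  : val ≤ℝ 1ℝ
open 𝕀 public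

infix 4 _≤ᴵ_ _≈ᴵ_

_≤ᴵ_ _≈ᴵ_ : 𝕀 → 𝕀 → Set
s ≤ᴵ t = val s ≤ℝ val t
s ≈ᴵ t = val s ≈ℝ val t

private
  termwise : ∀ x y → (∀ n → seq x n ℚ.≤ seq y n) → x ≤ℝ y
  termwise _ y x≤y ε 0<ε =
    0 , λ n _ → ℚ.≤-trans (x≤y n) (p≤p+ε (seq y n) 0<ε)

  0≤1 : 0ℚ ℚ.≤ 1ℚ
  0≤1 = ℚ.<⇒≤ (ℚ.positive⁻¹ 1ℚ)

  ⊓-glbℝ : ∀ x y z → z ≤ℝ x → z ≤ℝ y → z ≤ℝ (x ⊓ℝ y)
  ⊓-glbℝ x y z z≤x z≤y ε 0<ε with z≤x ε 0<ε | z≤y ε 0<ε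
  ... | M , p | N , q = M ℕ.⊔ N , λ n M⊔N≤n →
    subst (seq z n ℚ.≤_)
      (sym (ℚ.mono-≤-distrib-⊓ (ℚ.+-monoˡ-≤ ε) (seq x n) (seq y n)))
      (ℚ.⊓-glb (p n (ℕ.m⊔n≤o⇒m≤o M N M⊔N≤n)) (q n (ℕ.m⊔n≤o⇒n≤o M N M⊔N≤n)))

  ⊔-lubℝ : ∀ x y z → x ≤ℝ z → y ≤ℝ z → (x ⊔ℝ y) ≤ℝ z
  ⊔-lubℝ x y z x≤z y≤z ε 0<ε with x≤z ε 0<ε | y≤z ε 0<ε
  ... | M , p | N , q = M ℕ.⊔ N , λ n M⊔N≤n →
    ℚ.⊔-lub (p n (ℕ.m⊔n≤o⇒m≤o M N M⊔N≤n)) (q n (ℕ.m⊔n≤o⇒n≤o M N M⊔N≤n))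

  +-monoℝ : ∀ w x y z → w ≤ℝ x → y ≤ℝ z → (w +ℝ y) ≤ℝ (x +ℝ z)
  +-monoℝ w x y z w≤x y≤z ε 0<ε
    with w≤x (half ε) (half-pos 0<ε) | y≤z (half ε) (half-pos 0<ε)
  ... | M , p | N , q = M ℕ.⊔ N , λ n M⊔N≤n →
    subst (seq w n ℚ.+ seq y n ℚ.≤_)
      (trans (interchange (seq x n) (seq z n) (half ε) (half ε))
             (cong (seq x n ℚ.+ seq z n ℚ.+_) (half+half ε)))
      (ℚ.+-mono-≤ (p n (ℕ.m⊔n≤o⇒m≤o M N M⊔N≤n)) (q n (ℕ.m⊔n≤o⇒n≤o M N M⊔N≤n)))

abstract
  0≤0ℝ : 0ℝ ≤ℝ 0ℝ
  0≤0ℝ = termwise 0ℝ 0ℝ λ _ → ℚ.≤-refl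

  0≤1ℝ : 0ℝ ≤ℝ 1ℝ
  0≤1ℝ = termwise 0ℝ 1ℝ λ _ → 0≤1

  1≤1ℝ : 1ℝ ≤ℝ 1ℝ
  1≤1ℝ = termwise 1ℝ 1ℝ λ _ → ℚ.≤-refl

  0≤⊕ : ∀ x y → 0ℝ ≤ℝ x → 0ℝ ≤ℝ y → 0ℝ ≤ℝ (x +ℝ y) ⊓ℝ 1ℝ
  0≤⊕ x y 0≤x 0≤y = ⊓-glbℝ (x +ℝ y) 1ℝ 0ℝ (+-monoℝ 0ℝ x 0ℝ y 0≤x 0≤y) 0≤1ℝ

  ⊕≤1 : ∀ x y → (x +ℝ y) ⊓ℝ 1ℝ ≤ℝ 1ℝ
  ⊕≤1 x y = termwise ((x +ℝ y) ⊓ℝ 1ℝ) 1ℝ λ n → ℚ.p⊓q≤q (seq x n ℚ.+ seq y n) 1ℚ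

  0≤⊙ : ∀ x y → 0ℝ ≤ℝ (x +ℝ y -ℝ 1ℝ) ⊔ℝ 0ℝ
  0≤⊙ x y = termwise 0ℝ ((x +ℝ y -ℝ 1ℝ) ⊔ℝ 0ℝ)
    λ n → ℚ.p≤q⊔p (seq (x +ℝ y -ℝ 1ℝ) n) 0ℚ

  ⊙≤1 : ∀ x y → x ≤ℝ 1ℝ → y ≤ℝ 1ℝ → (x +ℝ y -ℝ 1ℝ) ⊔ℝ 0ℝ ≤ℝ 1ℝ
  ⊙≤1 x y x≤1 y≤1 = ⊔-lubℝ (x +ℝ y -ℝ 1ℝ) 0ℝ 1ℝ
    (+-monoℝ (x +ℝ y) (1ℝ +ℝ 1ℝ) (-ℝ 1ℝ) (-ℝ 1ℝ)
      (+-monoℝ x 1ℝ y 1ℝ x≤1 y≤1)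
      (termwise (-ℝ 1ℝ) (-ℝ 1ℝ) λ _ → ℚ.≤-refl))
    0≤1ℝ

  0≤∧ : ∀ x y → 0ℝ ≤ℝ x → 0ℝ ≤ℝ y → 0ℝ ≤ℝ x ⊓ℝ y
  0≤∧ x y = ⊓-glbℝ x y 0ℝ

  ∧≤1 : ∀ x y → x ≤ℝ 1ℝ → x ⊓ℝ y ≤ℝ 1ℝ
  ∧≤1 x y x≤1 ε 0<ε = let (N , h) = x≤1 ε 0<ε in
    N , λ n N≤n → ℚ.≤-trans (ℚ.p⊓q≤p (seq x n) (seq y n)) (h n N≤n)

0ᴵ 1ᴵ : 𝕀
0ᴵ = mk𝕀 0ℝ 0≤0ℝ 0≤1ℝ
1ᴵ = mk𝕀 1ℝ 0≤1ℝ 1≤1ℝ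

infixl 6 _⊕_
infixl 7 _⊙_ _∧_

_⊕_ _⊙_ _∧_ : 𝕀 → 𝕀 → 𝕀
s ⊕ t = mk𝕀 ((val s +ℝ val t) ⊓ℝ 1ℝ)
  (0≤⊕ (val s) (val t) (0≤ s) (0≤ t)) (⊕≤1 (val s) (val t))
s ⊙ t = mk𝕀 ((val s +ℝ val t -ℝ 1ℝ) ⊔ℝ 0ℝ)
  (0≤⊙ (val s) (val t)) (⊙≤1 (val s) (val t) (≤1 s) (≤1 t))
s ∧ t = mk𝕀 (val s ⊓ℝ val t)
  (0≤∧ (val s) (val t) (0≤ s) (0≤ t)) (∧≤1 (val s) (val t) (≤1 s))

------------------------------------------------------------------------
-- [0,1]-valued functions, considered up to _≐_

private variable
  ℓ : Level

FuzzySet : Set ℓ → Set ℓ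
FuzzySet X = X → 𝕀

module _ {X : Set ℓ} where

  infix 4 _≐_
  _≐_ : FuzzySet X → FuzzySet X → Set ℓ
  α ≐ β = ∀ x → α x ≈ᴵ β x

  𝟎 𝟏 : FuzzySet X
  𝟎 _ = 0ᴵ
  𝟏 _ = 1ᴵ

  infixl 6 _⊕̇_
  infixl 7 _⊙̇_ _∧̇_

  _⊕̇_ _⊙̇_ _∧̇_ : FuzzySet X → FuzzySet X → FuzzySet X
  (α ⊕̇ β) x = α x ⊕ β x
  (α ⊙̇ β) x = α x ⊙ β x
  (α ∧̇ β) x = α x ∧ β x

  -- β x is the supremum in [0,1] of { γ x ∣ γ ∈ Γ }, for every x.
  IsJoin : Pred (FuzzySet X) ℓ → FuzzySet X → Set ℓ
  IsJoin Γ β = ∀ x →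
    (∀ γ → Γ γ → γ x ≤ᴵ β x) ×
    (∀ t → (∀ γ → Γ γ → γ x ≤ᴵ t) → β x ≤ᴵ t)

------------------------------------------------------------------------
-- MV-topological spaces

-- Points are compared by _≡_.  Open automatically respects _≐_, since any β
-- with α ≐ β is a join of the singleton family { α }.
record MVSpace (ℓ : Level) : Set (suc ℓ) where
  field
    Carrier : Set ℓ
    Open    : Pred (FuzzySet Carrier) ℓ
    𝟎-open  : Open 𝟎
    𝟏-open  : Open 𝟏
    ⋁-open  : ∀ (Γ : Pred (FuzzySet Carrier) ℓ) → Γ ⊆ Open →
              ∀ β → IsJoin Γ β → Open β
    ⊙-open  : ∀ α β → Open α → Open β → Open (α ⊙̇ β)
    ⊕-open  : ∀ α β → Open α → Open β → Open (α ⊕̇ β)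
    ∧-open  : ∀ α β → Open α → Open β → Open (α ∧̇ β)
open MVSpace public using (Carrier; Open)

record ContinuousMap (X Y : MVSpace ℓ) : Set ℓ where
  constructor mkContinuous
  field
    fun  : Carrier X → Carrier Y
    cont : ∀ α → Open Y α → Open X (α ∘ fun)
open ContinuousMap public

-- The finite family may be empty, with sum 𝟎; this matters only for the empty
-- space, which is thereby compact.
Compact : MVSpace ℓ → Set (suc ℓ)
Compact {ℓ} X = ∀ (Γ : Pred (FuzzySet (Carrier X)) ℓ) → Γ ⊆ Open X →
  IsJoin Γ 𝟏 → ∃[ αs ] (All Γ αs × foldr _⊕̇_ 𝟎 αs ≐ 𝟏)

Hausdorff : MVSpace ℓ → Set ℓ
Hausdorff X = ∀ x y → x ≢ y → ∃[ oˣ ] ∃[ oʸ ]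
  (Open X oˣ × Open X oʸ × oˣ x ≈ᴵ 1ᴵ × oʸ y ≈ᴵ 1ᴵ × oˣ ∧̇ oʸ ≐ 𝟎)

------------------------------------------------------------------------
-- Categories, functors, adjunctions

record Category (o h e : Level) : Set (suc (o ⊔ h ⊔ e)) where
  infix  4 _≈_
  infixr 9 _∘ᶜ_
  field
    Obj       : Set o
    Hom       : Obj → Obj → Set h
    _≈_       : ∀ {A B} → Hom A B → Hom A B → Set e
    idᶜ       : ∀ {A} → Hom A A
    _∘ᶜ_      : ∀ {A B C} → Hom B C → Hom A B → Hom A C
    equiv     : ∀ {A B} → IsEquivalence (_≈_ {A} {B})
    ∘-resp-≈  : ∀ {A B C} {f g : Hom B C} {h k : Hom A B} →
                f ≈ g → h ≈ k → f ∘ᶜ h ≈ g ∘ᶜ k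
    identityˡ : ∀ {A B} {f : Hom A B} → idᶜ ∘ᶜ f ≈ f
    identityʳ : ∀ {A B} {f : Hom A B} → f ∘ᶜ idᶜ ≈ f
    assoc     : ∀ {A B C D} {f : Hom C D} {g : Hom B C} {h : Hom A B} →
                (f ∘ᶜ g) ∘ᶜ h ≈ f ∘ᶜ (g ∘ᶜ h)

record Functor {o h e o′ h′ e′}
               (C : Category o h e) (D : Category o′ h′ e′) :
               Set (o ⊔ h ⊔ e ⊔ o′ ⊔ h′ ⊔ e′) where
  private
    module C = Category C
    module D = Category D
  field
    F₀       : C.Obj → D.Obj
    F₁       : ∀ {A B} → C.Hom A B → D.Hom (F₀ A) (F₀ B)
    F-resp-≈ : ∀ {A B} {f g : C.Hom A B} → f C.≈ g → F₁ f D.≈ F₁ g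
    F-id     : ∀ {A} → F₁ (C.idᶜ {A}) D.≈ D.idᶜ
    F-∘      : ∀ {A B C} {f : C.Hom B C} {g : C.Hom A B} →
               F₁ (f C.∘ᶜ g) D.≈ F₁ f D.∘ᶜ F₁ g

record _⊣_ {o h e o′ h′ e′} {C : Category o h e} {D : Category o′ h′ e′}
           (L : Functor D C) (R : Functor C D) :
           Set (o ⊔ h ⊔ e ⊔ o′ ⊔ h′ ⊔ e′) where
  private
    module C = Category C
    module D = Category D
    module L = Functor L
    module R = Functor R
  field
    unit           : ∀ X → D.Hom X (R.F₀ (L.F₀ X))
    unit-natural   : ∀ {X Y} (f : D.Hom X Y) →
                     unit Y D.∘ᶜ f D.≈ R.F₁ (L.F₁ f) D.∘ᶜ unit X
    counit         : ∀ A → C.Hom (L.F₀ (R.F₀ A)) A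
    counit-natural : ∀ {A B} (f : C.Hom A B) →
                     counit B C.∘ᶜ L.F₁ (R.F₁ f) C.≈ f C.∘ᶜ counit A
    zig            : ∀ X → counit (L.F₀ X) C.∘ᶜ L.F₁ (unit X) C.≈ C.idᶜ
    zag            : ∀ A → R.F₁ (counit A) D.∘ᶜ unit (R.F₀ A) D.≈ D.idᶜ

HasLeftAdjoint : ∀ {o h e o′ h′ e′}
                 {C : Category o h e} {D : Category o′ h′ e′} →
                 Functor C D → Set (o ⊔ h ⊔ e ⊔ o′ ⊔ h′ ⊔ e′)
HasLeftAdjoint {C = C} {D} R = Σ (Functor D C) (_⊣ R)

module _ {o h e p} (C : Category o h e) (P : Pred (Category.Obj C) p) where
  open Category C

  FullSubcategory : Category (o ⊔ p) h e
  FullSubcategory = record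
    { Obj       = Σ Obj P
    ; Hom       = λ A B → Hom (proj₁ A) (proj₁ B)
    ; _≈_       = _≈_
    ; idᶜ       = idᶜ
    ; _∘ᶜ_      = _∘ᶜ_
    ; equiv     = equiv
    ; ∘-resp-≈  = ∘-resp-≈
    ; identityˡ = identityˡ
    ; identityʳ = identityʳ
    ; assoc     = assoc
    }

  Inclusion : Functor FullSubcategory C
  Inclusion = record
    { F₀       = proj₁
    ; F₁       = id
    ; F-resp-≈ = id
    ; F-id     = IsEquivalence.refl equiv
    ; F-∘      = IsEquivalence.refl equiv
    }

-- All carriers and all sets of fuzzy sets live at one level ℓ, which plays the
-- role of the universe of sets.
MVTop : ∀ ℓ → Category (suc ℓ) ℓ ℓ
MVTop ℓ = record
  { Obj       = MVSpace ℓ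
  ; Hom       = ContinuousMap
  ; _≈_       = λ f g → fun f ≗ fun g
  ; idᶜ       = mkContinuous id (λ _ → id)
  ; _∘ᶜ_      = λ g f → mkContinuous (fun g ∘ fun f)
                  (λ α → cont f (α ∘ fun g) ∘ cont g α)
  ; equiv     = record
    { refl  = λ _ → refl
    ; sym   = λ f≗g x → sym (f≗g x)
    ; trans = λ f≗g g≗h x → trans (f≗g x) (g≗h x)
    }
  ; ∘-resp-≈  = λ {_} {_} {_} {f} {_} {_} {k} f≗g h≗k x →
                  trans (cong (fun f) (h≗k x)) (f≗g (fun k x))
  ; identityˡ = λ _ → refl
  ; identityʳ = λ _ → refl
  ; assoc     = λ _ → refl
  }

IsHC : Pred (MVSpace ℓ) (suc ℓ)
IsHC X = Compact X × Hausdorff X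

HCMVTop : ∀ ℓ → Category (suc ℓ) ℓ ℓ
HCMVTop ℓ = FullSubcategory (MVTop ℓ) IsHC

i : ∀ ℓ → Functor (HCMVTop ℓ) (MVTop ℓ)
i ℓ = Inclusion (MVTop ℓ) IsHC

{-# OPTIONS --safe #-}

-- The crisp open sets of a compact Hausdorff MV-space C form a compact Hausdorff
-- topology for which every open fuzzy set α is lower semicontinuous: iterating
-- x ⊕ x and x ⊙ x separates any two thresholds, so compactness and the Hausdorff
-- property give each point c a neighbourhood on which α stays above α c - ε.
-- Conversely, compactness only involves such crisp information.
--
-- The reflection of X is therefore a Stone–Čech compactification: ultrafilters
-- on X, identified when they have the same limit under every continuous map to a
-- compact Hausdorff space.  A fuzzy set on it is open when it is lower
-- semicontinuous and its restriction to X is open.  Continuous maps to compact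
-- Hausdorff spaces extend by taking limits, uniquely since X is dense.
--
-- Excluded middle for arbitrary types provides both choice, which yields
-- ultrafilters and representatives, and propositional resizing, which lets the
-- identification quantify over all compact Hausdorff spaces.
module Submission where

open import Defs
open import Level using (Level; _⊔_) renaming (suc to lsuc)
open import Axiom.ExcludedMiddle using (ExcludedMiddle)
open import Axiom.Extensionality.Propositional using (Extensionality)
open import Axiom.UniquenessOfIdentityProofs.WithK using (uip)
open import Data.Bool.Base using (Bool; true; false; not)
open import Data.Empty using (⊥; ⊥-elim)
import Data.Integer.Base as ℤ
import Data.Integer.Properties as ℤ
open import Data.List.Base using (List; []; _∷_; _++_; foldr; map)
open import Data.List.Relation.Unary.All as All using (All; []; _∷_)
import Data.List.Relation.Unary.All.Properties as All
open import Data.List.Relation.Unary.Any as Any using (Any; here; there)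
import Data.List.Relation.Unary.Any.Properties as Any
open import Data.Nat.Base as ℕ using (ℕ; zero; suc)
import Data.Nat.Properties as ℕ
open import Data.Product.Base using (Σ; ∃-syntax; _×_; _,_; proj₁; proj₂)
open import Data.Rational.Base as ℚ using (ℚ; mkℚ; 0ℚ; 1ℚ; ½; _+_; _*_; -_; 1/_)
import Data.Rational.Properties as ℚ
open import Data.Rational.Solver using (module +-*-Solver)
import Data.Rational.Unnormalised.Base as ℚᵘ
import Data.Rational.Unnormalised.Properties as ℚᵘ
open import Data.Sum.Base as Sum using (_⊎_; inj₁; inj₂)
open import Function.Base using (_∘_; id)
open import Relation.Binary.PropositionalEquality
  using (_≡_; _≢_; refl; sym; trans; cong; subst; subst₂)
open import Relation.Binary.Structures using (IsEquivalence)
open import Relation.Nullary using (¬_; Dec; yes; no; does)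
open import Relation.Nullary.Decidable.Core using (from-yes)
open import Relation.Unary using (Pred)

open +-*-Solver using (solve; con; _:=_; _:+_; _:*_; :-_)

-- Rational arithmetic and powers of one half

-- The equation says q - p = v - u, in a form without subtraction for the ring solver.
≤-shift : ∀ {u v} p q → u ℚ.≤ v → q + u ≡ p + v → p ℚ.≤ q
≤-shift {u} {v} p q u≤v eq = subst₂ ℚ._≤_ (cancel p v) (cancel q v)
  (ℚ.+-monoˡ-≤ (- v) (subst (ℚ._≤ q + v) eq (ℚ.+-monoʳ-≤ q u≤v)))
  where
  cancel : ∀ a b → (a + b) + - b ≡ a
  cancel = solve 2 (λ a b → (a :+ b) :+ :- b := a) refl

half-positive : ∀ {ε} → 0ℚ ℚ.< ε → 0ℚ ℚ.< ½ * ε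
half-positive {ε} 0<ε =
  subst (ℚ._< ½ * ε) (ℚ.*-zeroʳ ½) (ℚ.*-monoʳ-<-pos ½ 0<ε)

half-mono : ∀ {p q} → p ℚ.≤ q → ½ * p ℚ.≤ ½ * q
half-mono = ℚ.*-monoˡ-≤-nonNeg ½

ι : ℕ → ℚ
ι zero    = 0ℚ
ι (suc n) = ι n + 1ℚ

toℚᵘ-ι : ∀ n → ℚ.toℚᵘ (ι n) ℚᵘ.≃ ℚᵘ.mkℚᵘ (ℤ.+ n) 0
toℚᵘ-ι zero    = ℚᵘ.≃-refl
toℚᵘ-ι (suc n) = ℚᵘ.≃-trans (ℚ.toℚᵘ-homo-+ (ι n) 1ℚ)
  (ℚᵘ.≃-trans (ℚᵘ.+-congˡ (ℚ.toℚᵘ 1ℚ) (toℚᵘ-ι n)) (ℚᵘ.*≡* numerators))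
  where
  numerators : (ℤ.+ n ℤ.* ℤ.+ 1 ℤ.+ ℤ.+ 1 ℤ.* ℤ.+ 1) ℤ.* ℤ.+ 1 ≡ ℤ.+ suc n ℤ.* ℤ.+ 1
  numerators = cong (ℤ._* ℤ.+ 1)
    (trans (cong (ℤ._+ ℤ.+ 1) (ℤ.*-identityʳ (ℤ.+ n))) (cong ℤ.+_ (ℕ.+-comm n 1)))

-- The numerator serves as bound, since the denominator is at least 1.
archimedean : ∀ p → .{{ℚ.Positive p}} → ∃[ n ] p ℚ.≤ ι n
archimedean p@(mkℚ (ℤ.+ n) d _) = n , ℚ.toℚᵘ-cancel-≤
  (ℚᵘ.≤-respʳ-≃ (ℚᵘ.≃-sym (toℚᵘ-ι n))
    (ℚᵘ.*≤* (ℤ.*-monoˡ-≤-nonNeg (ℤ.+ n) (ℤ.+≤+ (ℕ.s≤s ℕ.z≤n)))))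

½^ : ℕ → ℚ
½^ zero    = 1ℚ
½^ (suc n) = ½ * ½^ n

½^≤1 : ∀ n → ½^ n ℚ.≤ 1ℚ
½^≤1 zero    = ℚ.≤-refl
½^≤1 (suc n) = ℚ.≤-trans (half-mono (½^≤1 n)) (ℚ.<⇒≤ (ℚ.*<* (ℤ.+<+ (ℕ.s≤s (ℕ.s≤s ℕ.z≤n)))))

½^-positive : ∀ n → 0ℚ ℚ.< ½^ n
½^-positive zero    = ℚ.positive⁻¹ 1ℚ
½^-positive (suc n) = half-positive (½^-positive n)

-- This is n ≤ 2ⁿ without division. The inductive step averages the hypothesis with `½^≤1`.
½^*ι≤1 : ∀ n → ½^ n * ι n ℚ.≤ 1ℚ
½^*ι≤1 zero    = ℚ.<⇒≤ (ℚ.positive⁻¹ 1ℚ)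
½^*ι≤1 (suc n) = ≤-shift _ _ (half-mono (ℚ.+-mono-≤ (½^*ι≤1 n) (½^≤1 n)))
  (solve 2 (λ h k → con 1ℚ :+ con ½ :* (h :* k :+ h)
                      := (con ½ :* h) :* (k :+ con 1ℚ) :+ con ½ :* (con 1ℚ :+ con 1ℚ)) refl (½^ n) (ι n))

½^-vanishes : ∀ ε → 0ℚ ℚ.< ε → ∃[ n ] ½^ n ℚ.≤ ε
½^-vanishes ε 0<ε = n , ℚ.*-cancelʳ-≤-pos (1/ ε)
  (ℚ.≤-trans (ℚ.*-monoˡ-≤-nonNeg (½^ n) 1/ε≤n)
    (subst (½^ n * ι n ℚ.≤_) (sym (ℚ.*-inverseʳ ε)) (½^*ι≤1 n)))
  where
  instance
    ε-positive : ℚ.Positive ε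
    ε-positive = ℚ.positive 0<ε
    ε-nonZero : ℚ.NonZero ε
    ε-nonZero = ℚ.pos⇒nonZero ε
    1/ε-positive : ℚ.Positive (1/ ε)
    1/ε-positive = ℚ.1/pos⇒pos ε
  bound = archimedean (1/ ε)
  n = proj₁ bound
  1/ε≤n = proj₂ bound
  instance
    ½^-nonNegative : ℚ.NonNegative (½^ n)
    ½^-nonNegative = ℚ.nonNegative (ℚ.<⇒≤ (½^-positive n))

-- Approximate inequalities in [0,1]

eventually₂ : ∀ {P Q R : ℕ → Set} → (∀ n → P n → Q n → R n) →
  Eventually P → Eventually Q → Eventually R
eventually₂ h (M , p) (N , q) = M ℕ.⊔ N , λ n M⊔N≤n →
  h n (p n (ℕ.m⊔n≤o⇒m≤o M N M⊔N≤n)) (q n (ℕ.m⊔n≤o⇒n≤o M N M⊔N≤n))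

eventually₁ : ∀ {P R : ℕ → Set} → (∀ n → P n → R n) → Eventually P → Eventually R
eventually₁ h (N , p) = N , λ n N≤n → h n (p n N≤n)

eventually₀ : ∀ {R : ℕ → Set} → (∀ n → R n) → Eventually R
eventually₀ h = 0 , λ n _ → h n

-- x ≤ y + ε, as a record so that x and y can be inferred; x ≤ℝ y asserts it for
-- all ε > 0.
infix 4 _≤[_]_
record _≤[_]_ (x : ℝ) (ε : ℚ) (y : ℝ) : Set where
  constructor near
  field eventually : Eventually (λ n → seq x n ℚ.≤ seq y n + ε)
open _≤[_]_

private variable
  x y z : ℝ
  a b δ ε : ℚ

≤⇒≤[] : ∀ x y → x ≤ℝ y → 0ℚ ℚ.< ε → x ≤[ ε ] y
≤⇒≤[] _ _ x≤y 0<ε = near (x≤y _ 0<ε)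

≤[]-trans : x ≤[ δ ] y → y ≤[ ε ] z → x ≤[ δ + ε ] z
≤[]-trans {x} {δ} {y} {ε} {z} (near p) (near q) = near (eventually₂ (λ n h k →
  ≤-shift _ _ (ℚ.+-mono-≤ h k)
    (solve 5 (λ a b c d e → (c :+ (d :+ e)) :+ (a :+ b) := a :+ ((b :+ d) :+ (c :+ e))) refl
      (seq x n) (seq y n) (seq z n) δ ε)) p q)

half+half : ∀ ε → ½ * ε + ½ * ε ≡ ε
half+half = solve 1 (λ e → con ½ :* e :+ con ½ :* e := e) refl

≤[]-trans-½ : x ≤[ ½ * ε ] y → y ≤[ ½ * ε ] z → x ≤[ ε ] z
≤[]-trans-½ {x} {ε} {y} {z} p q = subst (x ≤[_] z) (half+half ε) (≤[]-trans p q)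

≤ℝ-refl : ∀ x → x ≤ℝ x
≤ℝ-refl x ε 0<ε = eventually₀ λ n → p≤p+ε (seq x n) 0<ε

≤ℝ-trans : ∀ x y z → x ≤ℝ y → y ≤ℝ z → x ≤ℝ z
≤ℝ-trans x y z x≤y y≤z ε 0<ε = eventually
  (≤[]-trans-½ (≤⇒≤[] x y x≤y (half-positive 0<ε)) (≤⇒≤[] y z y≤z (half-positive 0<ε)))

fromℚ-mono : a ℚ.≤ b → fromℚ a ≤ℝ fromℚ b
fromℚ-mono {b = b} a≤b ε 0<ε = eventually₀ λ _ → ℚ.≤-trans a≤b (p≤p+ε b 0<ε)

≤ᴵ-trans : ∀ s t u → s ≤ᴵ t → t ≤ᴵ u → s ≤ᴵ u
≤ᴵ-trans s t u = ≤ℝ-trans (val s) (val t) (val u)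

⊓-near : ∀ p q p′ q′ → p ℚ.≤ p′ + ε → q ℚ.≤ q′ + ε → p ℚ.⊓ q ℚ.≤ p′ ℚ.⊓ q′ + ε
⊓-near {ε} p q p′ q′ h k = subst (p ℚ.⊓ q ℚ.≤_)
  (sym (ℚ.mono-≤-distrib-⊓ (ℚ.+-monoˡ-≤ ε) p′ q′)) (ℚ.⊓-mono-≤ h k)

⊔-near : ∀ p q p′ q′ → p ℚ.≤ p′ + ε → q ℚ.≤ q′ + ε → p ℚ.⊔ q ℚ.≤ p′ ℚ.⊔ q′ + ε
⊔-near {ε} p q p′ q′ h k = subst (p ℚ.⊔ q ℚ.≤_)
  (sym (ℚ.mono-≤-distrib-⊔ (ℚ.+-monoˡ-≤ ε) p′ q′)) (ℚ.⊔-mono-≤ h k)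

private
  +-near : ∀ ε p q p′ q′ → p ℚ.≤ p′ + ½ * ε → q ℚ.≤ q′ + ½ * ε → p + q ℚ.≤ (p′ + q′) + ε
  +-near ε p q p′ q′ h k = ≤-shift _ _ (ℚ.+-mono-≤ h k)
    (solve 5 (λ p q p′ q′ e → ((p′ :+ q′) :+ e) :+ (p :+ q)
                := (p :+ q) :+ ((p′ :+ con ½ :* e) :+ (q′ :+ con ½ :* e))) refl p q p′ q′ ε)

-- Errors in the two arguments add up, so each gets half the tolerance. For all ε this yields
-- monotonicity; at a fixed ε it carries semicontinuity through the operation.
⊕-near : ∀ s t s′ t′ → 0ℚ ℚ.< ε → val s ≤[ ½ * ε ] val s′ → val t ≤[ ½ * ε ] val t′ →
  val (s ⊕ t) ≤[ ε ] val (s′ ⊕ t′)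
⊕-near {ε} s t s′ t′ 0<ε (near p) (near q) = near (eventually₂ (λ n h k →
  ⊓-near _ 1ℚ (seq (val s′) n + seq (val t′) n) 1ℚ
    (+-near ε (seq (val s) n) (seq (val t) n) (seq (val s′) n) (seq (val t′) n) h k) (p≤p+ε 1ℚ 0<ε)) p q)

⊙-near : ∀ s t s′ t′ → 0ℚ ℚ.< ε → val s ≤[ ½ * ε ] val s′ → val t ≤[ ½ * ε ] val t′ →
  val (s ⊙ t) ≤[ ε ] val (s′ ⊙ t′)
⊙-near {ε} s t s′ t′ 0<ε (near p) (near q) = near (eventually₂ (λ n h k →
  ⊔-near (seq (val s) n + seq (val t) n + - 1ℚ) 0ℚ (seq (val s′) n + seq (val t′) n + - 1ℚ) 0ℚ
    (≤-shift _ _ (+-near ε (seq (val s) n) (seq (val t) n) (seq (val s′) n) (seq (val t′) n) h k)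
      (solve 4 (λ p q r e → (((q :+ :- r) :+ e) :+ p) := ((p :+ :- r) :+ (q :+ e))) refl
        (seq (val s) n + seq (val t) n) (seq (val s′) n + seq (val t′) n) 1ℚ ε))
    (p≤p+ε 0ℚ 0<ε)) p q)

∧-near : ∀ s t s′ t′ → 0ℚ ℚ.< ε → val s ≤[ ½ * ε ] val s′ → val t ≤[ ½ * ε ] val t′ →
  val (s ∧ t) ≤[ ε ] val (s′ ∧ t′)
∧-near {ε} s t s′ t′ 0<ε (near p) (near q) = near (eventually₂ (λ n h k →
  ⊓-near (seq (val s) n) (seq (val t) n) (seq (val s′) n) (seq (val t′) n)
    (ℚ.≤-trans h (ℚ.+-monoʳ-≤ (seq (val s′) n) ½ε≤ε))
    (ℚ.≤-trans k (ℚ.+-monoʳ-≤ (seq (val t′) n) ½ε≤ε))) p q)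
  where
  ½ε≤ε : ½ * ε ℚ.≤ ε
  ½ε≤ε = subst (½ * ε ℚ.≤_) (half+half ε) (p≤p+ε (½ * ε) (half-positive 0<ε))

⊕-mono : ∀ s t s′ t′ → s ≤ᴵ s′ → t ≤ᴵ t′ → s ⊕ t ≤ᴵ s′ ⊕ t′
⊕-mono s t s′ t′ p q ε 0<ε = eventually (⊕-near s t s′ t′ 0<ε
  (≤⇒≤[] (val s) (val s′) p (half-positive 0<ε)) (≤⇒≤[] (val t) (val t′) q (half-positive 0<ε)))

0⊕-≤ : ∀ t → 0ᴵ ⊕ t ≤ᴵ t
0⊕-≤ t ε 0<ε = eventually₀ λ n → ℚ.≤-trans (ℚ.p⊓q≤p (0ℚ + seq (val t) n) 1ℚ)
  (subst (ℚ._≤ seq (val t) n + ε) (sym (ℚ.+-identityˡ (seq (val t) n))) (p≤p+ε (seq (val t) n) 0<ε))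

-- Writing t as `t ⊓ t` lets one copy be compared with 0 + t and the other with 1.
≤-0⊕ : ∀ t → t ≤ᴵ 0ᴵ ⊕ t
≤-0⊕ t ε 0<ε = eventually₁ (λ n h → subst (ℚ._≤ (0ℚ + seq (val t) n) ℚ.⊓ 1ℚ + ε)
  (ℚ.⊓-idem (seq (val t) n))
  (⊓-near (seq (val t) n) (seq (val t) n) (0ℚ + seq (val t) n) 1ℚ
    (subst (λ p → seq (val t) n ℚ.≤ p + ε) (sym (ℚ.+-identityˡ (seq (val t) n)))
      (p≤p+ε (seq (val t) n) 0<ε)) h))
  (≤1 t ε 0<ε)

⊕-comm-≤ : ∀ s t → s ⊕ t ≤ᴵ t ⊕ s
⊕-comm-≤ s t ε 0<ε = eventually₀ λ n →
  subst (λ p → p ℚ.⊓ 1ℚ ℚ.≤ (seq (val t) n + seq (val s) n) ℚ.⊓ 1ℚ + ε)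
    (ℚ.+-comm (seq (val t) n) (seq (val s) n))
    (p≤p+ε ((seq (val t) n + seq (val s) n) ℚ.⊓ 1ℚ) 0<ε)

≤-⊕ʳ : ∀ s t → t ≤ᴵ s ⊕ t
≤-⊕ʳ s t = ≤ᴵ-trans t (0ᴵ ⊕ t) (s ⊕ t) (≤-0⊕ t) (⊕-mono 0ᴵ t s t (0≤ s) (≤ℝ-refl (val t)))

≤-⊕ˡ : ∀ s t → s ≤ᴵ s ⊕ t
≤-⊕ˡ s t = ≤ᴵ-trans s (t ⊕ s) (s ⊕ t) (≤-⊕ʳ t s) (⊕-comm-≤ t s)

∧-glb : ∀ s t u → u ≤ᴵ s → u ≤ᴵ t → u ≤ᴵ s ∧ t
∧-glb s t u p q ε 0<ε = eventually₂ (λ n h k → subst (ℚ._≤ seq (val s) n ℚ.⊓ seq (val t) n + ε)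
  (ℚ.⊓-idem (seq (val u) n)) (⊓-near _ _ (seq (val s) n) (seq (val t) n) h k)) (p ε 0<ε) (q ε 0<ε)

<⇒≱ℚ : ∀ {p q} → p ℚ.< q → ¬ q ℚ.≤ p
<⇒≱ℚ p<q q≤p = ℚ.<-irrefl refl (ℚ.<-≤-trans p<q q≤p)

1≰0 : ∀ ε → ε ℚ.< 1ℚ → ¬ 1ℝ ≤[ ε ] 0ℝ
1≰0 ε ε<1 (near (N , h)) = <⇒≱ℚ ε<1
  (subst (1ℚ ℚ.≤_) (ℚ.+-identityˡ ε) (h N ℕ.≤-refl))

½<1 : ½ ℚ.< 1ℚ
½<1 = ℚ.*<* (ℤ.+<+ (ℕ.s≤s (ℕ.s≤s ℕ.z≤n)))

-- Values equal to 0 or to 1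

Is0 Is1 : 𝕀 → Set
Is0 s = s ≈ᴵ 0ᴵ
Is1 s = s ≈ᴵ 1ᴵ

≤0⇒Is0 : ∀ s → s ≤ᴵ 0ᴵ → Is0 s
≤0⇒Is0 s p = p , 0≤ s

1≤⇒Is1 : ∀ s → 1ᴵ ≤ᴵ s → Is1 s
1≤⇒Is1 s p = ≤1 s , p

Is1⇒¬Is0 : ∀ s → Is1 s → ¬ Is0 s
Is1⇒¬Is0 s (_ , p) (q , _) =
  1≰0 ½ ½<1 (≤⇒≤[] 1ℝ 0ℝ (≤ℝ-trans 1ℝ (val s) 0ℝ p q) (ℚ.positive⁻¹ ½))

near-1⇒¬Is0 : ∀ s t → Is1 s → val s ≤[ ½ ] val t → ¬ Is0 t
near-1⇒¬Is0 s t (_ , 1≤s) s≤t (t≤0 , _) =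
  -- The three errors ¼, ½ and ⅛ sum to ⅞, which is still below 1.
  1≰0 ((½ * ½ + ½) + ½ * (½ * ½)) (from-yes (((½ * ½ + ½) + ½ * (½ * ½)) ℚ.<? 1ℚ))
  (≤[]-trans (≤[]-trans (≤⇒≤[] 1ℝ (val s) 1≤s (from-yes (0ℚ ℚ.<? (½ * ½)))) s≤t)
     (≤⇒≤[] (val t) 0ℝ t≤0 (from-yes (0ℚ ℚ.<? (½ * (½ * ½))))))

⊕-Is0 : ∀ s t → Is0 s → Is0 t → Is0 (s ⊕ t)
⊕-Is0 s t (p , _) (q , _) = ≤0⇒Is0 (s ⊕ t)
  (≤ᴵ-trans (s ⊕ t) (0ᴵ ⊕ 0ᴵ) 0ᴵ (⊕-mono s t 0ᴵ 0ᴵ p q) (0⊕-≤ 0ᴵ))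

∧-Is1 : ∀ s t → Is1 s → Is1 t → Is1 (s ∧ t)
∧-Is1 s t (_ , p) (_ , q) = 1≤⇒Is1 (s ∧ t) (∧-glb s t 1ᴵ p q)

∧-Is0ˡ : ∀ s t → Is0 s → Is0 (s ∧ t)
∧-Is0ˡ s t (p , _) = ≤0⇒Is0 (s ∧ t) (λ ε 0<ε → eventually₁
  (λ n → ℚ.≤-trans (ℚ.p⊓q≤p (seq (val s) n) (seq (val t) n))) (p ε 0<ε))

∧-Is0ʳ : ∀ s t → Is0 t → Is0 (s ∧ t)
∧-Is0ʳ s t (p , _) = ≤0⇒Is0 (s ∧ t) (λ ε 0<ε → eventually₁
  (λ n → ℚ.≤-trans (ℚ.p⊓q≤q (seq (val s) n) (seq (val t) n))) (p ε 0<ε))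

double-Is1 : ∀ s → 1ℝ ≤[ ½ ] val s → Is1 (s ⊕ s)
double-Is1 s (near p) = 1≤⇒Is1 (s ⊕ s) λ ε 0<ε → eventually₁ (λ n h →
  let 2s = seq (val s) n + seq (val s) n in
  subst (ℚ._≤ 2s ℚ.⊓ 1ℚ + ε) (ℚ.⊓-idem 1ℚ) (⊓-near 1ℚ 1ℚ 2s 1ℚ
    (ℚ.≤-trans (≤-shift 1ℚ 2s (ℚ.+-mono-≤ h h)
        (solve 1 (λ a → (a :+ a) :+ (con 1ℚ :+ con 1ℚ)
                    := con 1ℚ :+ ((a :+ con ½) :+ (a :+ con ½))) refl (seq (val s) n)))
      (p≤p+ε 2s 0<ε))
    (p≤p+ε 1ℚ 0<ε))) p

-- Threshold words

-- Syntax for one-variable MV-terms, read from the outside in: `dbl` stretches [0, ½] over [0, 1]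
-- before the rest of the word acts, and `sqr` stretches [½, 1]. The constant `one` handles values
-- close to 0.
data Word : Set where
  one var : Word
  dbl sqr : Word → Word

⟦_⟧ʷ : Word → 𝕀 → 𝕀
⟦ one   ⟧ʷ s = 1ᴵ
⟦ var   ⟧ʷ s = s
⟦ dbl w ⟧ʷ s = ⟦ w ⟧ʷ (s ⊕ s)
⟦ sqr w ⟧ʷ s = ⟦ w ⟧ʷ (s ⊙ s)

word-open : ∀ {ℓ} (X : MVSpace ℓ) w α → Open X α → Open X (⟦ w ⟧ʷ ∘ α)
word-open X one     α αᵒ = MVSpace.𝟏-open X
word-open X var     α αᵒ = αᵒ
word-open X (dbl w) α αᵒ = word-open X w (α ⊕̇ α) (MVSpace.⊕-open X α α αᵒ αᵒ)
word-open X (sqr w) α αᵒ = word-open X w (α ⊙̇ α) (MVSpace.⊙-open X α α αᵒ αᵒ)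

-- Gap w a b: the word w is 0 on [0, a] and 1 on [b, 1].
data Gap : Word → ℚ → ℚ → Set where
  unit  : Gap var 0ℚ 1ℚ
  lower : ∀ {w a b} → Gap w a b → Gap (dbl w) (½ * a) (½ * b)
  upper : ∀ {w a b} → Gap w a b → Gap (sqr w) (½ * a + ½) (½ * b + ½)

gap-0≤ : ∀ {w} → Gap w a b → 0ℚ ℚ.≤ a
gap-0≤ unit      = ℚ.≤-refl
gap-0≤ (lower g) = half-mono (gap-0≤ g)
gap-0≤ (upper g) = ℚ.+-mono-≤ (half-mono (gap-0≤ g)) (ℚ.<⇒≤ (ℚ.positive⁻¹ ½))

gap-≤1 : ∀ {w} → Gap w a b → b ℚ.≤ 1ℚ
gap-≤1 unit      = ℚ.≤-refl
gap-≤1 (lower g) = ℚ.≤-trans (half-mono (gap-≤1 g)) (ℚ.<⇒≤ ½<1)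
gap-≤1 (upper g) = ℚ.+-monoˡ-≤ ½ (half-mono (gap-≤1 g))

double-≤ : ∀ s → val s ≤ℝ fromℚ (½ * a) → val (s ⊕ s) ≤ℝ fromℚ a
double-≤ {a} s p ε 0<ε = eventually₁ (λ n h →
  ℚ.≤-trans (ℚ.p⊓q≤p (seq (val s) n + seq (val s) n) 1ℚ)
    (≤-shift _ _ (ℚ.+-mono-≤ h h)
      (solve 3 (λ s a e → (a :+ e) :+ (s :+ s)
                  := (s :+ s) :+ ((con ½ :* a :+ con ½ :* e) :+ (con ½ :* a :+ con ½ :* e)))
        refl (seq (val s) n) a ε)))
  (p (½ * ε) (half-positive 0<ε))

-- The sum in `s ⊕ s` may be cut off at 1, which still leaves it above b because b ≤ 1.
double-≥ : ∀ s → b ℚ.≤ 1ℚ → fromℚ (½ * b) ≤ℝ val s → fromℚ b ≤ℝ val (s ⊕ s)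
double-≥ {b} s b≤1 p ε 0<ε = eventually₁ (λ n h →
  subst (ℚ._≤ (seq (val s) n + seq (val s) n) ℚ.⊓ 1ℚ + ε) (ℚ.⊓-idem b)
    (⊓-near b b (seq (val s) n + seq (val s) n) 1ℚ
      (≤-shift _ _ (ℚ.+-mono-≤ h h)
        (solve 3 (λ s b e → ((s :+ s) :+ e) :+ (con ½ :* b :+ con ½ :* b)
                    := b :+ ((s :+ con ½ :* e) :+ (s :+ con ½ :* e)))
          refl (seq (val s) n) b ε))
      (ℚ.≤-trans b≤1 (p≤p+ε 1ℚ 0<ε))))
  (p (½ * ε) (half-positive 0<ε))

square-≤ : ∀ s → 0ℚ ℚ.≤ a → val s ≤ℝ fromℚ (½ * a + ½) → val (s ⊙ s) ≤ℝ fromℚ a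
square-≤ {a} s 0≤a p ε 0<ε = eventually₁ (λ n h →
  ℚ.⊔-lub {_} {seq (val s) n + seq (val s) n + - 1ℚ}
    (≤-shift _ _ (ℚ.+-mono-≤ h h)
      (solve 3 (λ s a e → (a :+ e) :+ (s :+ s)
                  := ((s :+ s) :+ con (- 1ℚ))
                       :+ (((con ½ :* a :+ con ½) :+ con ½ :* e) :+ ((con ½ :* a :+ con ½) :+ con ½ :* e)))
        refl (seq (val s) n) a ε))
    (ℚ.≤-trans 0≤a (p≤p+ε a 0<ε)))
  (p (½ * ε) (half-positive 0<ε))

square-≥ : ∀ s → fromℚ (½ * b + ½) ≤ℝ val s → fromℚ b ≤ℝ val (s ⊙ s)
square-≥ {b} s p ε 0<ε = eventually₁ (λ n h →
  ℚ.≤-trans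
    (≤-shift b (seq (val s) n + seq (val s) n + - 1ℚ + ε) (ℚ.+-mono-≤ h h)
      (solve 3 (λ s b e → (((s :+ s) :+ con (- 1ℚ)) :+ e)
                            :+ ((con ½ :* b :+ con ½) :+ (con ½ :* b :+ con ½))
                  := b :+ ((s :+ con ½ :* e) :+ (s :+ con ½ :* e)))
        refl (seq (val s) n) b ε))
    (ℚ.+-monoˡ-≤ ε (ℚ.p≤p⊔q (seq (val s) n + seq (val s) n + - 1ℚ) 0ℚ)))
  (p (½ * ε) (half-positive 0<ε))

gap-below : ∀ {w} → Gap w a b → ∀ s → val s ≤ℝ fromℚ a → Is0 (⟦ w ⟧ʷ s)
gap-below unit      s p = ≤0⇒Is0 s p
gap-below (lower {a = a} g) s p = gap-below g (s ⊕ s) (double-≤ {a} s p)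
gap-below (upper g) s p = gap-below g (s ⊙ s) (square-≤ s (gap-0≤ g) p)

gap-above : ∀ {w} → Gap w a b → ∀ s → fromℚ b ≤ℝ val s → Is1 (⟦ w ⟧ʷ s)
gap-above unit      s p = 1≤⇒Is1 s p
gap-above (lower g) s p = gap-above g (s ⊕ s) (double-≥ s (gap-≤1 g) p)
gap-above (upper g) s p = gap-above g (s ⊙ s) (square-≥ s p)

-- The gaps with words of length n cut [0, 1] into 2ⁿ intervals, crossed from left
-- to right.
gap-induction : ∀ n (R : ℚ → Set) →
  (∀ w a b → Gap w a b → b ℚ.≤ a + ½^ n → R a → R b) → R 0ℚ → R 1ℚ
gap-induction zero    R step r = step var 0ℚ 1ℚ unit ℚ.≤-refl r
gap-induction (suc n) R step r =
  -- The right half is the same walk rescaled. It starts where the left half ends, as ½ * 1 and ½ *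
  -- 0 + ½ compute to the same rational.
  gap-induction n (λ a → R (½ * a + ½))
    (λ w a b g b≤a+δ → step (sqr w) _ _ (upper g)
      (≤-shift _ _ (half-mono b≤a+δ)
        (solve 3 (λ a b d → ((con ½ :* a :+ con ½) :+ con ½ :* d) :+ con ½ :* b
                    := (con ½ :* b :+ con ½) :+ con ½ :* (a :+ d)) refl a b (½^ n))))
    (gap-induction n (λ a → R (½ * a))
      (λ w a b g b≤a+δ → step (dbl w) _ _ (lower g)
        (subst (½ * b ℚ.≤_) (ℚ.*-distribˡ-+ ½ a (½^ n)) (half-mono b≤a+δ)))
      r)

-- Order and thresholds under excluded middle

module Classical (em : ∀ ℓ → ExcludedMiddle ℓ) where

  decide : ∀ {ℓ} (P : Set ℓ) → Dec P
  decide {ℓ} P = em ℓ {P}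

  by-contradiction : ∀ {ℓ} {P : Set ℓ} → ¬ ¬ P → P
  by-contradiction {P = P} ¬¬p with decide P
  ... | yes p = p
  ... | no ¬p = ⊥-elim (¬¬p ¬p)

  -- If x ≤ y fails, it fails by some ε at arbitrarily late indices. The Cauchy property at ½ε for
  -- both sequences then gives the reverse inequality at every index of a tail.
  ≰⇒≥ : ∀ x y → ¬ x ≤ℝ y → y ≤ℝ x
  ≰⇒≥ x y x≰y = by-contradiction λ y≰x → x≰y λ ε 0<ε → by-contradiction λ ¬near →
    y≰x λ δ 0<δ →
    let M , p = cauchy x (½ * ε) (half-positive 0<ε)
        N , q = cauchy y (½ * ε) (half-positive 0<ε)
        L = M ℕ.⊔ N
        far : ∃[ n ] (L ℕ.≤ n × ¬ seq x n ℚ.≤ seq y n + ε)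
        far = by-contradiction λ ¬far → ¬near (L , λ n L≤n → by-contradiction λ h → ¬far (n , L≤n , h))
        n , L≤n , h = far
    in L , λ m L≤m → ℚ.≤-trans
      (≤-shift _ _
        (ℚ.+-mono-≤ (ℚ.+-mono-≤ (p n m (ℕ.m⊔n≤o⇒m≤o M N L≤n) (ℕ.m⊔n≤o⇒m≤o M N L≤m))
          (q m n (ℕ.m⊔n≤o⇒n≤o M N L≤m) (ℕ.m⊔n≤o⇒n≤o M N L≤n))) (ℚ.<⇒≤ (ℚ.≰⇒> h)))
        (solve 5 (λ xm xn ym yn e → xm :+ ((xn :+ ym) :+ (yn :+ e))
            := ym :+ (((xm :+ con ½ :* e) :+ (yn :+ con ½ :* e)) :+ xn)) refl
          (seq x m) (seq x n) (seq y m) (seq y n) ε))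
      (p≤p+ε (seq x m) 0<δ)

  ≤ℝ-total : ∀ x y → x ≤ℝ y ⊎ y ≤ℝ x
  ≤ℝ-total x y with decide (x ≤ℝ y)
  ... | yes x≤y = inj₁ x≤y
  ... | no x≰y  = inj₂ (≰⇒≥ x y x≰y)

  ∧-Is0⁻ : ∀ s t → Is0 (s ∧ t) → Is0 s ⊎ Is0 t
  ∧-Is0⁻ s t (p , _) with ≤ℝ-total (val s) (val t)
  ... | inj₁ s≤t = inj₁ (≤0⇒Is0 s (≤ᴵ-trans s (s ∧ t) 0ᴵ (∧-glb s t s (≤ℝ-refl (val s)) s≤t) p))
  ... | inj₂ t≤s = inj₂ (≤0⇒Is0 t (≤ᴵ-trans t (s ∧ t) 0ᴵ (∧-glb s t t t≤s (≤ℝ-refl (val t))) p))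

  _∸ᴵ_ : 𝕀 → ∃[ δ ] 0ℚ ℚ.< δ → 𝕀
  s ∸ᴵ (δ , 0<δ) = mk𝕀 ((val s -ℝ fromℚ δ) ⊔ℝ 0ℝ)
    (λ ε 0<ε → eventually₀ λ n → ℚ.≤-trans (ℚ.p≤q⊔p (seq (val s) n + - δ) 0ℚ)
      (p≤p+ε ((seq (val s) n + - δ) ℚ.⊔ 0ℚ) 0<ε))
    (λ ε 0<ε → eventually₁ (λ n h → ℚ.⊔-lub {_} {seq (val s) n + - δ}
        (≤-shift _ _ (ℚ.+-mono-≤ h (ℚ.<⇒≤ 0<δ))
          (solve 3 (λ a e d → (con 1ℚ :+ e) :+ (a :+ con 0ℚ)
                      := (a :+ :- d) :+ ((con 1ℚ :+ e) :+ d)) refl (seq (val s) n) ε δ))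
        (ℚ.≤-trans (ℚ.<⇒≤ 0<ε) (≤-shift ε (1ℚ + ε) (ℚ.<⇒≤ (ℚ.positive⁻¹ 1ℚ))
          (solve 1 (λ e → (con 1ℚ :+ e) :+ con 0ℚ := e :+ con 1ℚ) refl ε)))) (≤1 s ε 0<ε))

  -- The second alternative is needed for the empty family, whose supremum in [0, 1]
  -- is 0.
  lub-approx : ∀ {i} {I : Set i} (g : I → 𝕀) (u : 𝕀) →
    (∀ t → (∀ i → g i ≤ᴵ t) → u ≤ᴵ t) → ∀ ε → 0ℚ ℚ.< ε →
    (∃[ i ] val u ≤[ ε ] val (g i)) ⊎ val u ≤[ ε ] 0ℝ
  lub-approx {I = I} g u lub ε 0<ε with decide (∃[ i ] ¬ g i ≤ᴵ (u ∸ᴵ (½ * ε , half-positive 0<ε)))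
  ... | yes (i , gi≰t) = inj₁ (i , near (eventually₁ (λ n h →
    ≤-shift _ _ (ℚ.≤-trans (ℚ.p≤p⊔q (seq (val u) n + - (½ * ε)) 0ℚ) h)
      (solve 3 (λ a b e → (b :+ e) :+ (a :+ :- (con ½ :* e)) := a :+ (b :+ con ½ :* e)) refl
        (seq (val u) n) (seq (val (g i)) n) ε))
    (≰⇒≥ (val (g i)) (val (u ∸ᴵ (½ * ε , half-positive 0<ε))) gi≰t (½ * ε) (half-positive 0<ε))))
  -- Now u - ½ε, truncated at 0, is an upper bound and so dominates u. The truncation must be in
  -- force, since otherwise u ≤ u - ½ε + ¼ε.
  ... | no none = inj₂ (near (eventually₁ vanishes
      (lub (u ∸ᴵ (½ * ε , 0<η)) (λ i → by-contradiction λ h → none (i , h)) (½ * η) (half-positive 0<η))))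
    where
    η = ½ * ε
    0<η = half-positive 0<ε
    vanishes : ∀ n → seq (val u) n ℚ.≤ (seq (val u) n + - η) ℚ.⊔ 0ℚ + ½ * η →
      seq (val u) n ℚ.≤ 0ℚ + ε
    vanishes n h with ℚ.⊔-sel (seq (val u) n + - η) 0ℚ
    ... | inj₁ e = ⊥-elim (<⇒≱ℚ (half-positive 0<η)
      (≤-shift _ _ (subst (λ p → seq (val u) n ℚ.≤ p + ½ * η) e h)
        (solve 2 (λ a d → con 0ℚ :+ a := con ½ :* d :+ ((a :+ :- d) :+ con ½ :* d)) refl
          (seq (val u) n) η)))
    ... | inj₂ e = ≤-shift _ _
      (ℚ.+-mono-≤ (subst (λ p → seq (val u) n ℚ.≤ p + ½ * η) e h)
        (ℚ.+-mono-≤ (ℚ.<⇒≤ 0<η) (ℚ.<⇒≤ (half-positive 0<η))))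
      (solve 2 (λ a e → let d = con ½ :* e in
        (con 0ℚ :+ e) :+ (a :+ (con 0ℚ :+ con 0ℚ))
          := a :+ ((con 0ℚ :+ con ½ :* d) :+ (d :+ con ½ :* d))) refl (seq (val u) n) ε)

  -- Either s ≤ η, where `one` suffices, or some gap of the dyadic grid has a + η ≤ s ≤ b + η. Its
  -- word is 1 at s because b ≤ a + η, and 0 at every t ≤ a; for t ≥ a, s exceeds t by little.
  threshold : ∀ s ε → 0ℚ ℚ.< ε →
    ∃[ w ] (Is1 (⟦ w ⟧ʷ s) × ∀ t → Is0 (⟦ w ⟧ʷ t) ⊎ val s ≤[ ε ] val t)
  threshold s ε 0<ε = gap-induction n R step base (λ ζ 0<ζ → eventually₁
      (λ k h → ℚ.≤-trans h (ℚ.+-monoˡ-≤ ζ (p≤p+ε 1ℚ 0<η))) (≤1 s ζ 0<ζ))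
    where
    -- A mesh of at most ¼ε, since the comparison in `close` loses η four times.
    small = ½^-vanishes (½ * (½ * ε)) (half-positive (half-positive 0<ε))
    n = proj₁ small
    η = ½^ n
    0<η = ½^-positive n

    Separated : Set
    Separated = ∃[ w ] (Is1 (⟦ w ⟧ʷ s) × ∀ t → Is0 (⟦ w ⟧ʷ t) ⊎ val s ≤[ ε ] val t)

    R : ℚ → Set
    R a = val s ≤ℝ fromℚ (a + η) → Separated

    close : ∀ {p q} r → p ℚ.≤ (q + η) + η → q ℚ.≤ r + η + η → p ℚ.≤ r + ε
    close {p} {q} r h k = ≤-shift _ _
      (ℚ.+-mono-≤ (ℚ.+-mono-≤ h k) (ℚ.+-mono-≤ (ℚ.+-mono-≤ η≤ η≤) (ℚ.+-mono-≤ η≤ η≤)))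
      (solve 5 (λ p q r d e → let f = con ½ :* (con ½ :* e) in
         (r :+ e) :+ ((p :+ q) :+ ((d :+ d) :+ (d :+ d)))
           := p :+ ((((q :+ d) :+ d) :+ ((r :+ d) :+ d)) :+ ((f :+ f) :+ (f :+ f)))) refl p q r η ε)
      where η≤ = proj₂ small

    base : R 0ℚ
    base s≤η = one , (≤ℝ-refl 1ℝ , ≤ℝ-refl 1ℝ) , λ t → inj₂ (near (eventually₂
      (λ k h h′ → close (seq (val t) k) h (ℚ.≤-trans h′ (p≤p+ε (seq (val t) k + η) 0<η)))
      (s≤η η 0<η) (0≤ t η 0<η)))

    step : ∀ w a b → Gap w a b → b ℚ.≤ a + η → R a → R b
    step w a b g b≤a+η r s≤b+η with ≤ℝ-total (val s) (fromℚ (a + η))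
    ... | inj₁ s≤a+η = r s≤a+η
    ... | inj₂ a+η≤s = w
      , gap-above g s (≤ℝ-trans (fromℚ b) (fromℚ (a + η)) (val s) (fromℚ-mono b≤a+η) a+η≤s)
      , λ t → apart t (≤ℝ-total (val t) (fromℚ a))
      where
      apart : ∀ t → val t ≤ℝ fromℚ a ⊎ fromℚ a ≤ℝ val t → Is0 (⟦ w ⟧ʷ t) ⊎ val s ≤[ ε ] val t
      apart t (inj₁ t≤a) = inj₁ (gap-below g t t≤a)
      apart t (inj₂ a≤t) = inj₂ (near (eventually₂
        (λ k h h′ → close (seq (val t) k) h (ℚ.≤-trans b≤a+η (ℚ.+-monoˡ-≤ η h′)))
        (s≤b+η η 0<η) (a≤t η 0<η)))

-- Ultrafilters

-- Bool-valued subsets form a set at the level of A, so that power sets need not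
-- leave a universe; excluded middle turns every predicate into one.
Subset : ∀ {a} → Set a → Set a
Subset A = A → Bool

infix 4 _∈_ _⊑_
_∈_ : ∀ {a} {A : Set a} → A → Subset A → Set
x ∈ S = S x ≡ true

_⊑_ : ∀ {a} {A : Set a} → Subset A → Subset A → Set a
S ⊑ T = ∀ x → x ∈ S → x ∈ T

Covers : ∀ {a} {A : Set a} → List (Subset A) → Set a
Covers Ss = ∀ x → Any (x ∈_) Ss

-- Applied to a set and its complement, `prime` is the usual dichotomy. Upward closure is `meet`
-- with equal sets, and `inhabited` excludes the empty set.
record Ultrafilter {a} (A : Set a) : Set a where
  field
    sets      : Subset (Subset A)
    prime     : ∀ Ss → Covers Ss → Any (_∈ sets) Ss
    meet      : ∀ S T R → S ∈ sets → T ∈ sets → (∀ x → x ∈ S → x ∈ T → x ∈ R) → R ∈ sets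
    inhabited : ∀ S → S ∈ sets → ∃[ x ] x ∈ S
open Ultrafilter

infix 4 _∋_
_∋_ : ∀ {a} {A : Set a} → Ultrafilter A → Subset A → Set
U ∋ S = S ∈ sets U

principal : ∀ {a} {A : Set a} → A → Ultrafilter A
principal x = record
  { sets      = λ S → S x
  ; prime     = λ _ covers → covers x
  ; meet      = λ _ _ _ x∈S x∈T h → h x x∈S x∈T
  ; inhabited = λ _ x∈S → x , x∈S
  }

-- Subsets from predicates and maximal families

module Choice (em : ∀ ℓ → ExcludedMiddle ℓ) (fe : ∀ a b → Extensionality a b) where
  open Classical em

  ⟪_⟫ : ∀ {a p} {A : Set a} → (A → Set p) → Subset A
  ⟪ P ⟫ x = does (decide (P x))

  ∈⁺ : ∀ {a p} {A : Set a} (P : A → Set p) x → P x → x ∈ ⟪ P ⟫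
  ∈⁺ P x px with decide (P x)
  ... | yes _  = refl
  ... | no ¬px = ⊥-elim (¬px px)

  ∈⁻ : ∀ {a p} {A : Set a} (P : A → Set p) x → x ∈ ⟪ P ⟫ → P x
  ∈⁻ P x x∈ with decide (P x)
  ... | yes px = px

  ⊑-antisym : ∀ {a} {A : Set a} {S T : Subset A} → S ⊑ T → T ⊑ S → S ≡ T
  ⊑-antisym {S = S} {T} S⊑T T⊑S = fe _ _ pointwise
    where
    pointwise : ∀ x → S x ≡ T x
    pointwise x with S x in p | T x in q
    ... | true  | true  = refl
    ... | false | false = refl
    ... | true  | false = trans (sym (S⊑T x p)) q
    ... | false | true  = trans (sym p) (T⊑S x q)

  insert : ∀ {a} {A : Set a} → A → Subset A → Subset A
  insert x F = ⟪ (λ y → y ∈ F ⊎ y ≡ x) ⟫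

  -- The Teichmüller–Tukey lemma: the tower generated from F₀ by adding single
  -- elements and taking unions is a chain, and its largest member is maximal.
  module Tukey {a b} {A : Set a} (Bad : List A → Set b) (F₀ : Subset A) where

    Good : Subset A → Set (a ⊔ b)
    Good F = ∀ xs → All (_∈ F) xs → ¬ Bad xs

    Extendable : Subset A → Set (a ⊔ b)
    Extendable F = ∃[ x ] (¬ x ∈ F × Good (insert x F))

    extend : Subset A → Subset A
    extend F with decide (Extendable F)
    ... | yes (x , _) = insert x F
    ... | no _        = F

    ⋃ : Subset (Subset A) → Subset A
    ⋃ 𝒞 = ⟪ (λ x → x ∈ F₀ ⊎ ∃[ F ] (F ∈ 𝒞 × x ∈ F)) ⟫

    -- The tower starts at `F₀`, which is the join of the empty family.
    data Tower : Subset A → Set a where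
      step : ∀ {F} → Tower F → Tower (extend F)
      join : ∀ 𝒞 → (∀ F → F ∈ 𝒞 → Tower F) → Tower (⋃ 𝒞)

    insert-⊒ : ∀ x (F : Subset A) → F ⊑ insert x F
    insert-⊒ x F y y∈F = ∈⁺ (λ y → y ∈ F ⊎ y ≡ x) y (inj₁ y∈F)

    extend-⊒ : ∀ F → F ⊑ extend F
    extend-⊒ F with decide (Extendable F)
    ... | yes (x , _) = insert-⊒ x F
    ... | no _        = λ _ → id

    ⋃-⊒F₀ : ∀ 𝒞 → F₀ ⊑ ⋃ 𝒞
    ⋃-⊒F₀ 𝒞 x x∈F₀ = ∈⁺ (λ x → x ∈ F₀ ⊎ ∃[ F ] (F ∈ 𝒞 × x ∈ F)) x (inj₁ x∈F₀)

    ⋃-⊒ : ∀ 𝒞 F → F ∈ 𝒞 → F ⊑ ⋃ 𝒞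
    ⋃-⊒ 𝒞 F F∈𝒞 x x∈F = ∈⁺ (λ x → x ∈ F₀ ⊎ ∃[ F ] (F ∈ 𝒞 × x ∈ F)) x (inj₂ (F , F∈𝒞 , x∈F))

    ∈⋃⁻ : ∀ 𝒞 x → x ∈ ⋃ 𝒞 → x ∈ F₀ ⊎ ∃[ F ] (F ∈ 𝒞 × x ∈ F)
    ∈⋃⁻ 𝒞 = ∈⁻ (λ x → x ∈ F₀ ⊎ ∃[ F ] (F ∈ 𝒞 × x ∈ F))

    tower-⊒F₀ : ∀ {F} → Tower F → F₀ ⊑ F
    tower-⊒F₀ (step {F} tF) x = extend-⊒ F x ∘ tower-⊒F₀ tF x
    tower-⊒F₀ (join 𝒞 _)    = ⋃-⊒F₀ 𝒞

    -- Stronger than inclusion one way or the other: nothing in the tower falls strictly between G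
    -- and its successor. In this form the induction passes through `step`.
    Comparable : Subset A → Subset A → Set a
    Comparable F G = F ⊑ G ⊎ extend G ⊑ F

    comparable-step : ∀ {F G} → Comparable F G → Comparable G F → Comparable (extend F) G
    comparable-step _ (inj₂ eF⊑G) = inj₁ eF⊑G
    comparable-step (inj₁ F⊑G) (inj₁ G⊑F) =
      inj₂ (λ x → subst (λ H → x ∈ extend H) (⊑-antisym G⊑F F⊑G))
    comparable-step {F} (inj₂ eG⊑F) (inj₁ _) = inj₂ (λ x → extend-⊒ F x ∘ eG⊑F x)

    comparable-join : ∀ {𝒞 G} → (∀ F → F ∈ 𝒞 → Comparable F G) → F₀ ⊑ G → Comparable (⋃ 𝒞) G
    comparable-join {𝒞} {G} h F₀⊑G with decide (∃[ F ] (F ∈ 𝒞 × extend G ⊑ F))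
    ... | yes (F , F∈𝒞 , eG⊑F) = inj₂ (λ x → ⋃-⊒ 𝒞 F F∈𝒞 x ∘ eG⊑F x)
    ... | no none = inj₁ λ x x∈⋃ → Sum.[ F₀⊑G x , (λ (F , F∈𝒞 , x∈F) →
      Sum.[ (λ F⊑G → F⊑G x x∈F) , (λ eG⊑F → ⊥-elim (none (F , F∈𝒞 , eG⊑F))) ]′ (h F F∈𝒞)) ]′
      (∈⋃⁻ 𝒞 x x∈⋃)

    -- A double induction: `comparable-step` needs both directions, so for each F the converse is
    -- proved by an inner induction on G.
    comparable : ∀ {F} → Tower F → ∀ {G} → Tower G → Comparable F G
    comparable (step {F} tF) tG = comparable-step (comparable tF tG) (converse tG)
      where
      converse : ∀ {G} → Tower G → Comparable G F
      converse (step tG)  = comparable-step (converse tG) (comparable tF tG)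
      converse (join 𝒞 h) = comparable-join (λ G G∈𝒞 → converse (h G G∈𝒞)) (tower-⊒F₀ tF)
    comparable (join 𝒞 h) tG = comparable-join (λ F F∈𝒞 → comparable (h F F∈𝒞) tG) (tower-⊒F₀ tG)

    tower-total : ∀ {F G} → Tower F → Tower G → F ⊑ G ⊎ G ⊑ F
    tower-total {F} {G} tF tG = Sum.map₂ (λ eG⊑F x → eG⊑F x ∘ extend-⊒ G x) (comparable tF tG)

    -- Since the tower is a chain, the finitely many members used have a largest one. This is why
    -- goodness, a condition on finite lists, survives unions.
    ⋃-compact : ∀ 𝒞 → (∀ F → F ∈ 𝒞 → Tower F) → ∀ xs → All (_∈ ⋃ 𝒞) xs →
      All (_∈ F₀) xs ⊎ ∃[ F ] (F ∈ 𝒞 × All (_∈ F) xs)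
    ⋃-compact 𝒞 h [] [] = inj₁ []
    ⋃-compact 𝒞 h (x ∷ xs) (x∈ ∷ xs∈) with ∈⋃⁻ 𝒞 x x∈ | ⋃-compact 𝒞 h xs xs∈
    ... | inj₁ x∈F₀ | inj₁ xs∈F₀ = inj₁ (x∈F₀ ∷ xs∈F₀)
    ... | inj₁ x∈F₀ | inj₂ (F , F∈𝒞 , xs∈F) = inj₂ (F , F∈𝒞 , tower-⊒F₀ (h F F∈𝒞) x x∈F₀ ∷ xs∈F)
    ... | inj₂ (F , F∈𝒞 , x∈F) | inj₁ xs∈F₀ =
      inj₂ (F , F∈𝒞 , x∈F ∷ All.map (tower-⊒F₀ (h F F∈𝒞) _) xs∈F₀)
    ... | inj₂ (F , F∈𝒞 , x∈F) | inj₂ (G , G∈𝒞 , xs∈G) with tower-total (h F F∈𝒞) (h G G∈𝒞)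
    ...   | inj₁ F⊑G = inj₂ (G , G∈𝒞 , F⊑G x x∈F ∷ xs∈G)
    ...   | inj₂ G⊑F = inj₂ (F , F∈𝒞 , x∈F ∷ All.map (G⊑F _) xs∈G)

    tower-good : Good F₀ → ∀ {F} → Tower F → Good F
    tower-good good₀ (step {F} tF) with decide (Extendable F)
    ... | yes (_ , _ , good) = good
    ... | no _               = tower-good good₀ tF
    tower-good good₀ (join 𝒞 h) xs xs∈ with ⋃-compact 𝒞 h xs xs∈
    ... | inj₁ xs∈F₀             = good₀ xs xs∈F₀
    ... | inj₂ (F , F∈𝒞 , xs∈F) = tower-good good₀ (h F F∈𝒞) xs xs∈F

    top : Subset A
    top = ⋃ ⟪ Tower ⟫

    tower-top : Tower top
    tower-top = join ⟪ Tower ⟫ (∈⁻ Tower)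

    -- The whole tower lies below `top`, including `extend top`, so extending adds nothing.
    top-unextendable : ¬ Extendable top
    top-unextendable e with ⋃-⊒ ⟪ Tower ⟫ (extend top) (∈⁺ Tower _ (step tower-top))
    ... | et⊑t with decide (Extendable top)
    ...   | yes (x , x∉ , _) = x∉ (et⊑t x (∈⁺ (λ y → y ∈ top ⊎ y ≡ x) x (inj₂ refl)))
    ...   | no ¬e            = ¬e e

    maximal : ∀ x → ¬ x ∈ top → ∃[ xs ] (All (_∈ insert x top) xs × Bad xs)
    maximal x x∉ = by-contradiction λ none →
      top-unextendable (x , x∉ , λ xs xs∈ bad → none (xs , xs∈ , bad))

  -- Existence of ultrafilters

  module _ {a} {A : Set a} where

    open Tukey {A = Subset A} Covers using (Good; top; tower-good; tower-top; ⋃-⊒F₀; maximal)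

    -- Turns a cover that may use S into members of F covering everything outside S.
    remove : ∀ (F : Subset (Subset A)) S Ss → All (_∈ insert S F) Ss →
      ∃[ Ts ] (All (_∈ F) Ts × ∀ x → Any (x ∈_) Ss → x ∈ S ⊎ Any (x ∈_) Ts)
    remove F S [] [] = [] , [] , λ _ → inj₂
    remove F S (R ∷ Ss) (R∈ ∷ Ss∈) with ∈⁻ (λ T → T ∈ F ⊎ T ≡ S) R R∈ | remove F S Ss Ss∈
    ... | inj₁ R∈F | Ts , Ts∈F , h = R ∷ Ts , R∈F ∷ Ts∈F , λ where
      x (here x∈R)  → inj₂ (here x∈R)
      x (there any) → Sum.map₂ there (h x any)
    ... | inj₂ refl | Ts , Ts∈F , h = Ts , Ts∈F , λ where
      x (here x∈R)  → inj₁ x∈R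
      x (there any) → h x any

    -- The sets outside a maximal family without finite subcover form an ultrafilter.
    ultrafilter-avoiding : ∀ {p} (𝒜 : Subset A → Set p) →
      (∀ Ss → All 𝒜 Ss → ¬ Covers Ss) → ∃[ U ] (∀ S → 𝒜 S → ¬ (U ∋ S))
    ultrafilter-avoiding 𝒜 no-cover = U , λ S S∈𝒜 → avoids S (⋃-⊒F₀ F₀ _ S (∈⁺ 𝒜 S S∈𝒜))
      where
      F₀ = ⟪ 𝒜 ⟫
      M = top F₀

      good : Good F₀ M
      good = tower-good F₀ (λ Ss Ss∈ → no-cover Ss (All.map (∈⁻ 𝒜 _) Ss∈)) (tower-top F₀)

      complement : Subset (Subset A)
      complement S = not (M S)

      avoids : ∀ S → S ∈ M → ¬ S ∈ complement
      avoids S S∈M with M S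
      avoids S refl | true = λ ()

      outside : ∀ S → S ∈ complement → ¬ S ∈ M
      outside S S∈ S∈M = avoids S S∈M S∈

      intro : ∀ S → ¬ S ∈ M → S ∈ complement
      intro S S∉ with M S
      ... | true  = ⊥-elim (S∉ refl)
      ... | false = refl

      -- By maximality, adding S to M creates a finite cover, whose other members lie in M.
      cocover : ∀ S → S ∈ complement → ∃[ Ts ] (All (_∈ M) Ts × ∀ x → x ∈ S ⊎ Any (x ∈_) Ts)
      cocover S S∈ =
        let Ss , Ss∈ , covers = maximal F₀ S (outside S S∈)
            Ts , Ts∈ , h = remove M S Ss Ss∈
        in Ts , Ts∈ , λ x → h x (covers x)

      dichotomy : ∀ Ss → All (_∈ M) Ss ⊎ Any (_∈ complement) Ss
      dichotomy [] = inj₁ []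
      dichotomy (S ∷ Ss) with decide (S ∈ M) | dichotomy Ss
      ... | no S∉   | _        = inj₂ (here (intro S S∉))
      ... | yes _   | inj₂ any = inj₂ (there any)
      ... | yes S∈M | inj₁ all = inj₁ (S∈M ∷ all)

      U : Ultrafilter A
      U = record
        { sets = complement
        ; prime = λ Ss covers → Sum.[ (λ all → ⊥-elim (good Ss all covers)) , id ]′ (dichotomy Ss)
        ; meet = λ S T R S∈ T∈ h → intro R λ R∈M →
            let Ss , Ss∈M , coverS = cocover S S∈
                Ts , Ts∈M , coverT = cocover T T∈
            in good (R ∷ Ss ++ Ts) (R∈M ∷ All.++⁺ Ss∈M Ts∈M) λ x →
              Sum.[ (λ x∈S → Sum.[ (λ x∈T → here (h x x∈S x∈T)) , there ∘ Any.++⁺ʳ Ss ]′ (coverT x))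
                  , there ∘ Any.++⁺ˡ ]′ (coverS x)
        ; inhabited = λ S S∈ → by-contradiction λ empty →
            let Ss , Ss∈M , cover = cocover S S∈
            in good Ss Ss∈M λ x → Sum.[ (λ x∈S → ⊥-elim (empty (x , x∈S))) , id ]′ (cover x)
        }

-- Adjoints from universal arrows

record UniversalArrow {o h e o′ h′ e′} {C : Category o h e} {D : Category o′ h′ e′}
                      (R : Functor C D) (X : Category.Obj D) :
                      Set (o ⊔ h ⊔ e ⊔ o′ ⊔ h′ ⊔ e′) where
  private
    module C = Category C
    module D = Category D
    module R = Functor R
  field
    object    : C.Obj
    arrow     : D.Hom X (R.F₀ object)
    lift      : ∀ {A} → D.Hom X (R.F₀ A) → C.Hom object A
    lift-comm : ∀ {A} (f : D.Hom X (R.F₀ A)) → R.F₁ (lift f) D.∘ᶜ arrow D.≈ f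
    unique    : ∀ {A} (g h : C.Hom object A) →
                R.F₁ g D.∘ᶜ arrow D.≈ R.F₁ h D.∘ᶜ arrow → g C.≈ h

module _ {o h e o′ h′ e′} {C : Category o h e} {D : Category o′ h′ e′}
         (R : Functor C D) (universal : ∀ X → UniversalArrow R X) where
  private
    module C = Category C
    module D = Category D
    module R = Functor R
    module U X = UniversalArrow (universal X)
    module ≈ {A B} = IsEquivalence (D.equiv {A} {B})

    _⟩∘⟨refl : ∀ {A B E} {f g : D.Hom B E} {k : D.Hom A B} → f D.≈ g → f D.∘ᶜ k D.≈ g D.∘ᶜ k
    p ⟩∘⟨refl = D.∘-resp-≈ p ≈.refl

    refl⟩∘⟨_ : ∀ {A B E} {f : D.Hom B E} {g k : D.Hom A B} → g D.≈ k → f D.∘ᶜ g D.≈ f D.∘ᶜ k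
    refl⟩∘⟨ p = D.∘-resp-≈ ≈.refl p

    R-∘-arrow : ∀ {X A B} (g : C.Hom A B) {f : C.Hom (U.object X) A} {k : D.Hom X (R.F₀ A)} →
      R.F₁ f D.∘ᶜ U.arrow X D.≈ k → R.F₁ (g C.∘ᶜ f) D.∘ᶜ U.arrow X D.≈ R.F₁ g D.∘ᶜ k
    R-∘-arrow g p = ≈.trans (R.F-∘ ⟩∘⟨refl) (≈.trans D.assoc (refl⟩∘⟨ p))

    L₁ : ∀ {X Y} → D.Hom X Y → C.Hom (U.object X) (U.object Y)
    L₁ {X} {Y} f = U.lift X (U.arrow Y D.∘ᶜ f)

    L₁-arrow : ∀ {X Y} (f : D.Hom X Y) → R.F₁ (L₁ f) D.∘ᶜ U.arrow X D.≈ U.arrow Y D.∘ᶜ f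
    L₁-arrow {X} {Y} f = U.lift-comm X (U.arrow Y D.∘ᶜ f)

    counit : ∀ A → C.Hom (U.object (R.F₀ A)) A
    counit A = U.lift (R.F₀ A) D.idᶜ

    counit-arrow : ∀ A → R.F₁ (counit A) D.∘ᶜ U.arrow (R.F₀ A) D.≈ D.idᶜ
    counit-arrow A = U.lift-comm (R.F₀ A) D.idᶜ

    counit-∘-L₁ : ∀ {X} A (f : D.Hom X (R.F₀ A)) →
      R.F₁ (counit A C.∘ᶜ L₁ f) D.∘ᶜ U.arrow X D.≈ f
    counit-∘-L₁ A f = ≈.trans (R-∘-arrow (counit A) (L₁-arrow f))
      (≈.trans (≈.sym D.assoc) (≈.trans (counit-arrow A ⟩∘⟨refl) D.identityˡ))

  -- Maps out of a universal object agree once they agree after its arrow, so `unique` settles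
  -- functoriality, naturality of the counit and `zig`.
  leftAdjoint : HasLeftAdjoint R
  leftAdjoint = L , record
    { unit           = U.arrow
    ; unit-natural   = λ f → ≈.sym (L₁-arrow f)
    ; counit         = counit
    ; counit-natural = λ {A} {B} f → U.unique (R.F₀ A) _ _ (≈.trans (counit-∘-L₁ B (R.F₁ f))
        (≈.sym (≈.trans (R-∘-arrow f (counit-arrow A)) D.identityʳ)))
    ; zig            = λ X → U.unique X _ _ (≈.trans (counit-∘-L₁ (U.object X) (U.arrow X))
        (≈.sym (≈.trans (R.F-id ⟩∘⟨refl) D.identityˡ)))
    ; zag            = counit-arrow
    }
    where
    L : Functor D C
    L = record
      { F₀       = U.object
      ; F₁       = L₁
      ; F-resp-≈ = λ {X} {Y} {f} {g} f≈g → U.unique X _ _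
          (≈.trans (L₁-arrow f) (≈.trans (refl⟩∘⟨ f≈g) (≈.sym (L₁-arrow g))))
      ; F-id     = λ {X} → U.unique X _ _ (≈.trans (L₁-arrow D.idᶜ)
          (≈.trans D.identityʳ (≈.sym (≈.trans (R.F-id ⟩∘⟨refl) D.identityˡ))))
      ; F-∘      = λ {X} {Y} {Z} {f} {g} → U.unique X _ _ (≈.trans (L₁-arrow (f D.∘ᶜ g))
          (≈.sym (≈.trans (R-∘-arrow (L₁ f) (L₁-arrow g))
            (≈.trans (≈.sym D.assoc) (≈.trans (L₁-arrow f ⟩∘⟨refl) D.assoc)))))
      }

-- The compactification

module Reflection (em : ∀ ℓ → ExcludedMiddle ℓ) (fe : ∀ a b → Extensionality a b) where
  open Classical em
  open Choice em fe

  -- Quotients by chosen representatives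

  module Quotient {a r} {A : Set a} (_~_ : A → A → Set r) (equiv : IsEquivalence _~_) where
    private module ~ = IsEquivalence equiv

    choose : Subset A → A → A
    choose S x with decide (∃[ y ] y ∈ S)
    ... | yes (y , _) = y
    ... | no _        = x

    choose-∈ : ∀ S x → x ∈ S → choose S x ∈ S
    choose-∈ S x x∈S with decide (∃[ y ] y ∈ S)
    ... | yes (_ , y∈S) = y∈S
    ... | no _          = x∈S

    choose-irrelevant : ∀ S x y → x ∈ S → choose S x ≡ choose S y
    choose-irrelevant S x y x∈S with decide (∃[ z ] z ∈ S)
    ... | yes _   = refl
    ... | no none = ⊥-elim (none (x , x∈S))

    rep : A → A
    rep x = choose ⟪ x ~_ ⟫ x

    rep-~ : ∀ x → x ~ rep x
    rep-~ x = ∈⁻ (x ~_) (rep x) (choose-∈ ⟪ x ~_ ⟫ x (∈⁺ (x ~_) x ~.refl))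

    -- Equivalent elements have equal classes by extensionality, and on an inhabited subset `choose`
    -- ignores its default.
    rep-cong : ∀ {x y} → x ~ y → rep x ≡ rep y
    rep-cong {x} {y} x~y = trans
      (cong (λ S → choose S x) (⊑-antisym
        (λ z → ∈⁺ (y ~_) z ∘ ~.trans (~.sym x~y) ∘ ∈⁻ (x ~_) z)
        (λ z → ∈⁺ (x ~_) z ∘ ~.trans x~y ∘ ∈⁻ (y ~_) z)))
      (choose-irrelevant ⟪ y ~_ ⟫ x y (∈⁺ (y ~_) x (~.sym x~y)))

    -- Points are the representatives themselves, so the quotient stays at the level of `A` whatever
    -- the level of `_~_`.
    Quotient : Set a
    Quotient = ∃[ x ] rep x ≡ x

    equal : (k k′ : Quotient) → proj₁ k ≡ proj₁ k′ → k ≡ k′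
    equal (x , p) (_ , q) refl = cong (x ,_) (uip p q)

    class : A → Quotient
    class x = rep x , rep-cong (~.sym (rep-~ x))

    class-cong : ∀ {x y} → x ~ y → class x ≡ class y
    class-cong x~y = equal _ _ (rep-cong x~y)

    class-rep : ∀ k → class (proj₁ k) ≡ k
    class-rep k = equal _ _ (proj₂ k)

  private variable
    ℓ : Level

  supp : {X : Set ℓ} → FuzzySet X → Subset X
  supp α = ⟪ (λ x → ¬ Is0 (α x)) ⟫

  supp⁺ : {X : Set ℓ} (α : FuzzySet X) → ∀ x → ¬ Is0 (α x) → x ∈ supp α
  supp⁺ α = ∈⁺ (λ x → ¬ Is0 (α x))

  supp⁻ : {X : Set ℓ} (α : FuzzySet X) → ∀ x → x ∈ supp α → ¬ Is0 (α x)
  supp⁻ α = ∈⁻ (λ x → ¬ Is0 (α x))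

  not-both : {X : Set ℓ} (U : Ultrafilter X) (S T : Subset X) →
    U ∋ S → U ∋ T → (∀ x → x ∈ S → ¬ x ∈ T) → ⊥
  not-both U S T U∋S U∋T disjoint with Ultrafilter.inhabited U (λ _ → false)
    (Ultrafilter.meet U S T (λ _ → false) U∋S U∋T (λ x x∈S x∈T → ⊥-elim (disjoint x x∈S x∈T)))
  ... | _ , ()

  both : {X : Set ℓ} (U : Ultrafilter X) (S T : Subset X) → U ∋ S → U ∋ T →
    ∃[ R ] (U ∋ R × ∀ V → V ∋ R → V ∋ S × V ∋ T)
  both U S T U∋S U∋T = S∩T
    , Ultrafilter.meet U S T S∩T U∋S U∋T (λ x x∈S x∈T → ∈⁺ (λ x → x ∈ S × x ∈ T) x (x∈S , x∈T))
    , λ V V∋ → Ultrafilter.meet V S∩T S∩T S V∋ V∋ (λ x p _ → proj₁ (∈⁻ (λ x → x ∈ S × x ∈ T) x p))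
             , Ultrafilter.meet V S∩T S∩T T V∋ V∋ (λ x p _ → proj₂ (∈⁻ (λ x → x ∈ S × x ∈ T) x p))
    where S∩T = ⟪ (λ x → x ∈ S × x ∈ T) ⟫

  sum-positive : {X : Set ℓ} (αs : List (FuzzySet X)) → ∀ x →
    ¬ Is0 (foldr _⊕̇_ 𝟎 αs x) → Any (λ α → ¬ Is0 (α x)) αs
  sum-positive [] x h = ⊥-elim (h (≤0⇒Is0 0ᴵ (≤ℝ-refl 0ℝ)))
  sum-positive (α ∷ αs) x h with decide (Is0 (α x))
  ... | no αx≉0  = here αx≉0
  ... | yes αx≈0 = there (sum-positive αs x (h ∘ ⊕-Is0 (α x) (foldr _⊕̇_ 𝟎 αs x) αx≈0))

  join-𝟏 : {X : Set ℓ} (Γ : Pred (FuzzySet X) ℓ) →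
    (∀ x → ∃[ γ ] (Γ γ × Is1 (γ x))) → IsJoin Γ 𝟏
  join-𝟏 Γ h x = (λ γ _ → ≤1 (γ x)) , λ t bound →
    let γ , γ∈Γ , (_ , 1≤γx) = h x in ≤ᴵ-trans 1ᴵ (γ x) t 1≤γx (bound γ γ∈Γ)

  -- Limits of ultrafilters in a compact Hausdorff MV-space

  module Limits (C : MVSpace ℓ) (hc : IsHC C) {X : Set ℓ} (f : X → Carrier C) where
    private
      compact   = proj₁ hc
      hausdorff = proj₂ hc
      module 𝐂 = MVSpace C

    Converges : Ultrafilter X → Carrier C → Set ℓ
    Converges U c = ∀ o → Open C o → Is1 (o c) → U ∋ supp (o ∘ f)

    -- Without a limit, the opens whose supports avoid U reach 1 at every point. Finitely many of
    -- them sum to 1, their supports cover X, and primeness puts one into U.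
    converges-exists : ∀ U → ∃[ c ] Converges U c
    converges-exists U = by-contradiction λ none →
      let αs , αs∈Γ , sum≐1 = compact Γ proj₁ (join-𝟏 Γ (λ c → by-contradiction λ h →
            none (c , λ o oᵒ o≈1 → by-contradiction λ U∌o → h (o , (oᵒ , U∌o) , o≈1))))
          covers = λ x → Any.map⁺ (Any.map (λ {α} → supp⁺ (α ∘ f) x)
            (sum-positive αs (f x) (Is1⇒¬Is0 (foldr _⊕̇_ 𝟎 αs (f x)) (sum≐1 (f x)))))
      in contradictory αs αs∈Γ (Any.map⁻ (Ultrafilter.prime U (map (λ o → supp (o ∘ f)) αs) covers))
      where
      Γ : Pred (FuzzySet (Carrier C)) _
      Γ o = Open C o × ¬ (U ∋ supp (o ∘ f))
      contradictory : ∀ αs → All Γ αs → ¬ Any (λ o → U ∋ supp (o ∘ f)) αs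
      contradictory (α ∷ αs) ((_ , U∌α) ∷ _) (here U∋α)  = U∌α U∋α
      contradictory (α ∷ αs) (_ ∷ αs∈Γ)      (there any) = contradictory αs αs∈Γ any

    disjoint-supports : ∀ U o o′ → (∀ c → Is0 (o c) ⊎ Is0 (o′ c)) →
      U ∋ supp (o ∘ f) → U ∋ supp (o′ ∘ f) → ⊥
    disjoint-supports U o o′ h U∋o U∋o′ = not-both U _ _ U∋o U∋o′ λ x x∈o x∈o′ →
      Sum.[ supp⁻ (o ∘ f) x x∈o , supp⁻ (o′ ∘ f) x x∈o′ ] (h (f x))

    converges-unique : ∀ U c d → Converges U c → Converges U d → c ≡ d
    converges-unique U c d U→c U→d = by-contradiction λ c≢d →
      let o , o′ , oᵒ , o′ᵒ , oc≈1 , o′d≈1 , o∧o′≐0 = hausdorff c d c≢d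
      in disjoint-supports U o o′ (λ x → ∧-Is0⁻ (o x) (o′ x) (o∧o′≐0 x))
           (U→c o oᵒ oc≈1) (U→d o′ o′ᵒ o′d≈1)

    principal-converges : ∀ x → Converges (principal x) (f x)
    principal-converges x o _ o≈1 = supp⁺ (o ∘ f) x (Is1⇒¬Is0 (o (f x)) o≈1)

    abstract
      lim : Ultrafilter X → Carrier C
      lim U = proj₁ (converges-exists U)

      lim-converges : ∀ U → Converges U (lim U)
      lim-converges U = proj₂ (converges-exists U)

    lim-principal : ∀ x → lim (principal x) ≡ f x
    lim-principal x = converges-unique (principal x) _ _
      (lim-converges (principal x)) (principal-converges x)

    -- The points other than c have neighbourhoods disjoint from one of c; together
    -- with w ∘ α these cover C, so finitely many of them sum to 1 where w ∘ α is 0.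
    separate : ∀ c w α → Open C α → Is1 (⟦ w ⟧ʷ (α c)) →
      ∃[ o ] ∃[ o′ ] (Open C o × Open C o′ × Is1 (o′ c) × (∀ d → Is0 (o d) ⊎ Is0 (o′ d)) ×
        ∀ d → Is0 (⟦ w ⟧ʷ (α d)) → Is1 (o d))
    separate c w α αᵒ wαc≈1 =
      let αs , αs∈Γ , sum≐1 = compact Γ Γ-open (join-𝟏 Γ Γ-covers)
          o , (oᵒ , o′ , o′ᵒ , o′c≈1 , disjoint) , sum≤o = summary αs αs∈Γ
      in o , o′ , oᵒ , o′ᵒ , o′c≈1 , disjoint , λ d w≈0 →
        1≤⇒Is1 (o d) (≤ᴵ-trans 1ᴵ (foldr _⊕̇_ 𝟎 αs d) (o d) (proj₂ (sum≐1 d)) (sum≤o d w≈0))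
      where
      Away : Pred (FuzzySet (Carrier C)) _
      Away o = Open C o × ∃[ o′ ] (Open C o′ × Is1 (o′ c) × ∀ d → Is0 (o d) ⊎ Is0 (o′ d))

      Γ : Pred (FuzzySet (Carrier C)) _
      Γ o = o ≡ ⟦ w ⟧ʷ ∘ α ⊎ Away o

      Γ-open : ∀ {o} → Γ o → Open C o
      Γ-open (inj₁ refl)     = word-open C w α αᵒ
      Γ-open (inj₂ (oᵒ , _)) = oᵒ

      Γ-covers : ∀ d → ∃[ γ ] (Γ γ × Is1 (γ d))
      Γ-covers d with decide (d ≡ c)
      ... | yes refl = _ , inj₁ refl , wαc≈1
      ... | no d≢c   =
        let o , o′ , oᵒ , o′ᵒ , od≈1 , o′c≈1 , o∧o′≐0 = hausdorff d c d≢c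
        in o , inj₂ (oᵒ , o′ , o′ᵒ , o′c≈1 , λ x → ∧-Is0⁻ (o x) (o′ x) (o∧o′≐0 x)) , od≈1

      Away-𝟎 : Away 𝟎
      Away-𝟎 = 𝐂.𝟎-open , 𝟏 , 𝐂.𝟏-open , 1≤⇒Is1 1ᴵ (≤ℝ-refl 1ℝ) , λ _ → inj₁ (≤0⇒Is0 0ᴵ (≤ℝ-refl 0ℝ))

      Away-⊕ : ∀ o p → Away o → Away p → Away (o ⊕̇ p)
      Away-⊕ o p (oᵒ , o′ , o′ᵒ , o′c , h) (pᵒ , p′ , p′ᵒ , p′c , k) =
        𝐂.⊕-open o p oᵒ pᵒ , o′ ∧̇ p′ , 𝐂.∧-open o′ p′ o′ᵒ p′ᵒ ,
        ∧-Is1 (o′ c) (p′ c) o′c p′c , λ d → cases d (h d) (k d)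
        where
        cases : ∀ d → Is0 (o d) ⊎ Is0 (o′ d) → Is0 (p d) ⊎ Is0 (p′ d) →
          Is0 ((o ⊕̇ p) d) ⊎ Is0 ((o′ ∧̇ p′) d)
        cases d (inj₁ x) (inj₁ y) = inj₁ (⊕-Is0 (o d) (p d) x y)
        cases d (inj₂ x) _        = inj₂ (∧-Is0ˡ (o′ d) (p′ d) x)
        cases d _        (inj₂ y) = inj₂ (∧-Is0ʳ (o′ d) (p′ d) y)

      summary : ∀ αs → All Γ αs →
        ∃[ o ] (Away o × ∀ d → Is0 (⟦ w ⟧ʷ (α d)) → foldr _⊕̇_ 𝟎 αs d ≤ᴵ o d)
      summary [] [] = 𝟎 , Away-𝟎 , λ _ _ → ≤ℝ-refl 0ℝ
      summary (β ∷ βs) (β∈Γ ∷ βs∈Γ) with β∈Γ | summary βs βs∈Γ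
      -- This summand is 0 wherever `w ∘ α` is 0, so it is dropped from the bound.
      ... | inj₁ refl | o , away , h = o , away , λ d w≈0 →
        let rest = foldr _⊕̇_ 𝟎 βs d in
        ≤ᴵ-trans (⟦ w ⟧ʷ (α d) ⊕ rest) (0ᴵ ⊕ o d) (o d)
          (⊕-mono (⟦ w ⟧ʷ (α d)) rest 0ᴵ (o d) (proj₁ w≈0) (h d w≈0)) (0⊕-≤ (o d))
      ... | inj₂ β-away | o , away , h = β ⊕̇ o , Away-⊕ β o β-away away , λ d w≈0 →
        ⊕-mono (β d) (foldr _⊕̇_ 𝟎 βs d) (β d) (o d) (≤ℝ-refl (val (β d))) (h d w≈0)

    -- A threshold word is 1 at α c and 0 wherever α is lower by more than ε. By `separate`, an open
    -- `o` that is 1 on those points is disjoint from a neighbourhood `o′` of c. An ultrafilter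
    -- converging to such a point contains the support of `o ∘ f`, hence not that of `o′ ∘ f`.
    lim-semicontinuous : ∀ α → Open C α → ∀ U ε → 0ℚ ℚ.< ε →
      ∃[ S ] (U ∋ S × ∀ V → V ∋ S → val (α (lim U)) ≤[ ε ] val (α (lim V)))
    lim-semicontinuous α αᵒ U ε 0<ε = neighbourhood (threshold (α c) ε 0<ε)
      where
      c = lim U
      neighbourhood : ∃[ w ] (Is1 (⟦ w ⟧ʷ (α c)) × ∀ t → Is0 (⟦ w ⟧ʷ t) ⊎ val (α c) ≤[ ε ] val t) →
        ∃[ S ] (U ∋ S × ∀ V → V ∋ S → val (α c) ≤[ ε ] val (α (lim V)))
      neighbourhood (w , wαc≈1 , w-cases) =
        let o , o′ , oᵒ , o′ᵒ , o′c≈1 , disjoint , w≈0⇒o≈1 = separate c w α αᵒ wαc≈1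
        in supp (o′ ∘ f) , lim-converges U o′ o′ᵒ o′c≈1 , λ V V∋o′ → Sum.[
          (λ w≈0 → ⊥-elim (disjoint-supports V o o′ disjoint
            (lim-converges V o oᵒ (w≈0⇒o≈1 (lim V) w≈0)) V∋o′)) ,
          id ]′ (w-cases (α (lim V)))

  whole : ∀ {a} {A : Set a} (U : Ultrafilter A) → U ∋ (λ _ → true)
  whole U with Ultrafilter.prime U ((λ _ → true) ∷ []) (λ _ → here refl)
  ... | here U∋ = U∋

  -- The reflection of an MV-space

  module Compactification {ℓ : Level} (X : MVSpace ℓ) where

    private
      module 𝐗 = MVSpace X
      UF = Ultrafilter (Carrier X)

    infix 4 _~_
    _~_ : UF → UF → Set (lsuc ℓ)
    U ~ V = ∀ (C : MVSpace ℓ) (hc : IsHC C) (f : ContinuousMap X C) →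
      Limits.lim C hc (fun f) U ≡ Limits.lim C hc (fun f) V

    ~-isEquivalence : IsEquivalence _~_
    ~-isEquivalence = record
      { refl  = λ _ _ _ → refl
      ; sym   = λ U~V C hc f → sym (U~V C hc f)
      ; trans = λ U~V V~W C hc f → trans (U~V C hc f) (V~W C hc f)
      }

    open Quotient _~_ ~-isEquivalence renaming (Quotient to Point)

    η : Carrier X → Point
    η x = class (principal x)

    -- Lower semicontinuity of `α ∘ class`, where the ultrafilters containing a given S form a basic
    -- open set.
    Semicontinuous : FuzzySet Point → Set ℓ
    Semicontinuous α = ∀ U ε → 0ℚ ℚ.< ε →
      ∃[ S ] (U ∋ S × ∀ V → V ∋ S → val (α (class U)) ≤[ ε ] val (α (class V)))

    OpenK : Pred (FuzzySet Point) ℓ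
    OpenK α = Open X (α ∘ η) × Semicontinuous α

    constant-semicontinuous : ∀ s → Semicontinuous (λ _ → s)
    constant-semicontinuous s U ε 0<ε = (λ _ → true) , whole U ,
      λ _ _ → ≤⇒≤[] (val s) (val s) (≤ℝ-refl (val s)) 0<ε

    op-semicontinuous : (_·_ : 𝕀 → 𝕀 → 𝕀) →
      (∀ {ε} s t s′ t′ → 0ℚ ℚ.< ε → val s ≤[ ½ * ε ] val s′ → val t ≤[ ½ * ε ] val t′ →
        val (s · t) ≤[ ε ] val (s′ · t′)) →
      ∀ α β → Semicontinuous α → Semicontinuous β → Semicontinuous (λ k → α k · β k)
    op-semicontinuous _·_ ·-near α β α-sc β-sc U ε 0<ε =
      let S , U∋S , near-α = α-sc U (½ * ε) (half-positive 0<ε)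
          T , U∋T , near-β = β-sc U (½ * ε) (half-positive 0<ε)
          R , U∋R , split = both U S T U∋S U∋T
      in R , U∋R , λ V V∋R → ·-near (α (class U)) (β (class U)) (α (class V)) (β (class V)) 0<ε
           (near-α V (proj₁ (split V V∋R))) (near-β V (proj₂ (split V V∋R)))

    -- A member of Γ close to the supremum at U keeps the join high nearby. If the supremum there is
    -- nearly 0, the bound 0 suffices.
    join-semicontinuous : ∀ (Γ : Pred (FuzzySet Point) ℓ) β → (∀ {γ} → Γ γ → Semicontinuous γ) →
      IsJoin Γ β → Semicontinuous β
    join-semicontinuous Γ β Γ-sc join U ε 0<ε = Sum.[ attained , vanishing ]′
      (lub-approx {I = Σ (FuzzySet Point) Γ} (λ γ → proj₁ γ (class U)) (β (class U))
        (λ t bound → proj₂ (join (class U)) t (λ γ γ∈Γ → bound (γ , γ∈Γ))) (½ * ε) 0<½ε)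
      where
      0<½ε = half-positive 0<ε
      0<¼ε = half-positive 0<½ε
      Goal = ∃[ S ] (U ∋ S × ∀ V → V ∋ S → val (β (class U)) ≤[ ε ] val (β (class V)))

      attained : Σ (Σ (FuzzySet Point) Γ)
        (λ γ → val (β (class U)) ≤[ ½ * ε ] val (proj₁ γ (class U))) → Goal
      attained ((γ , γ∈Γ) , β≤γ) =
        let S , U∋S , near-γ = Γ-sc γ∈Γ U (½ * (½ * ε)) 0<¼ε
        in S , U∋S , λ V V∋S → ≤[]-trans-½ β≤γ (≤[]-trans-½ (near-γ V V∋S)
          (≤⇒≤[] (val (γ (class V))) (val (β (class V))) (proj₁ (join (class V)) γ γ∈Γ) 0<¼ε))

      vanishing : val (β (class U)) ≤[ ½ * ε ] 0ℝ → Goal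
      vanishing β≤0 = (λ _ → true) , whole U , λ V _ →
        ≤[]-trans-½ β≤0 (≤⇒≤[] 0ℝ (val (β (class V))) (0≤ (β (class V))) 0<½ε)

    K : MVSpace ℓ
    K = record
      { Carrier = Point
      ; Open    = OpenK
      ; 𝟎-open  = 𝐗.𝟎-open , constant-semicontinuous 0ᴵ
      ; 𝟏-open  = 𝐗.𝟏-open , constant-semicontinuous 1ᴵ
      ; ⋁-open  = λ Γ Γ⊆Open β join →
          𝐗.⋁-open (λ δ → ∃[ γ ] (Γ γ × δ ≡ γ ∘ η))
            (λ { (γ , γ∈Γ , refl) → proj₁ (Γ⊆Open γ∈Γ) }) (β ∘ η)
            (λ x → (λ { _ (γ , γ∈Γ , refl) → proj₁ (join (η x)) γ γ∈Γ })
                 , (λ t bound → proj₂ (join (η x)) t (λ γ γ∈Γ → bound (γ ∘ η) (γ , γ∈Γ , refl))))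
          , join-semicontinuous Γ β (proj₂ ∘ Γ⊆Open) join
      ; ⊙-open  = λ α β (αᵒ , α-sc) (βᵒ , β-sc) →
          𝐗.⊙-open (α ∘ η) (β ∘ η) αᵒ βᵒ , op-semicontinuous _⊙_ ⊙-near α β α-sc β-sc
      ; ⊕-open  = λ α β (αᵒ , α-sc) (βᵒ , β-sc) →
          𝐗.⊕-open (α ∘ η) (β ∘ η) αᵒ βᵒ , op-semicontinuous _⊕_ ⊕-near α β α-sc β-sc
      ; ∧-open  = λ α β (αᵒ , α-sc) (βᵒ , β-sc) →
          𝐗.∧-open (α ∘ η) (β ∘ η) αᵒ βᵒ , op-semicontinuous _∧_ ∧-near α β α-sc β-sc
      }

    unitMap : ContinuousMap X K
    unitMap = mkContinuous η (λ _ → proj₁)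

    -- Near each ultrafilter some member of Γ is at least ½, hence doubles to 1, on a basic set
    -- given by some S. If no finitely many such S covered X, an ultrafilter would avoid them all;
    -- given a finite cover, primeness makes every ultrafilter contain one of its sets.
    K-compact : Compact K
    K-compact Γ Γ⊆Open join =
      let Ss , Ss∈𝒜 , covers = finite-cover
          αs , αs∈Γ , sum≈1 = summands Ss Ss∈𝒜
      in αs , αs∈Γ , λ k → subst (λ k → Is1 (foldr _⊕̇_ 𝟎 αs k)) (class-rep k)
           (sum≈1 (proj₁ k) (Ultrafilter.prime (proj₁ k) Ss covers))
      where
      𝒜 : Subset (Carrier X) → Set ℓ
      𝒜 S = ∃[ γ ] (Γ γ × ∀ V → V ∋ S → Is1 (γ (class V) ⊕ γ (class V)))

      0<¼ : 0ℚ ℚ.< ½ * ½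
      0<¼ = half-positive (ℚ.positive⁻¹ ½)

      meets-𝒜 : ∀ U → ∃[ S ] (𝒜 S × U ∋ S)
      meets-𝒜 U = Sum.[
        (λ ((γ , γ∈Γ) , 1≤γ) →
          let S , U∋S , near-γ = proj₂ (Γ⊆Open γ∈Γ) U (½ * ½) 0<¼
          in S , (γ , γ∈Γ , λ V V∋S → double-Is1 (γ (class V))
               (≤[]-trans-½ 1≤γ (near-γ V V∋S))) , U∋S) ,
        (λ 1≤0 → ⊥-elim (1≰0 (½ * ½) (from-yes ((½ * ½) ℚ.<? 1ℚ)) 1≤0)) ]′
        (lub-approx {I = Σ (FuzzySet Point) Γ} (λ γ → proj₁ γ (class U)) 1ᴵ
          (λ t bound → proj₂ (join (class U)) t (λ γ γ∈Γ → bound (γ , γ∈Γ))) (½ * ½) 0<¼)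

      finite-cover : ∃[ Ss ] (All 𝒜 Ss × Covers Ss)
      finite-cover = by-contradiction λ none →
        let U , avoids = ultrafilter-avoiding 𝒜 (λ Ss Ss∈𝒜 covers → none (Ss , Ss∈𝒜 , covers))
            S , S∈𝒜 , U∋S = meets-𝒜 U
        in avoids S S∈𝒜 U∋S

      summands : ∀ Ss → All 𝒜 Ss →
        ∃[ αs ] (All Γ αs × ∀ V → Any (V ∋_) Ss → Is1 (foldr _⊕̇_ 𝟎 αs (class V)))
      summands [] [] = [] , [] , λ _ ()
      summands (S ∷ Ss) ((γ , γ∈Γ , γ⊕γ≈1) ∷ Ss∈𝒜) =
        let αs , αs∈Γ , sum≈1 = summands Ss Ss∈𝒜
        -- Each γ is listed twice because only its double is known to be 1.
        in γ ∷ γ ∷ αs , γ∈Γ ∷ γ∈Γ ∷ αs∈Γ , λ V any →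
          let s = γ (class V) ; rest = foldr _⊕̇_ 𝟎 αs (class V) in
          1≤⇒Is1 (s ⊕ (s ⊕ rest)) (1≤sum V s rest (λ V∋S → γ⊕γ≈1 V V∋S) (sum≈1 V) any)
        where
        1≤sum : ∀ V s rest → (V ∋ S → Is1 (s ⊕ s)) → (Any (V ∋_) Ss → Is1 rest) →
          Any (V ∋_) (S ∷ Ss) → 1ᴵ ≤ᴵ s ⊕ (s ⊕ rest)
        1≤sum V s rest h k (here V∋S)  = ≤ᴵ-trans 1ᴵ (s ⊕ s) (s ⊕ (s ⊕ rest)) (proj₂ (h V∋S))
          (⊕-mono s s s (s ⊕ rest) (≤ℝ-refl (val s)) (≤-⊕ˡ s rest))
        1≤sum V s rest h k (there any) = ≤ᴵ-trans 1ᴵ rest (s ⊕ (s ⊕ rest)) (proj₂ (k any))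
          (≤ᴵ-trans rest (s ⊕ rest) (s ⊕ (s ⊕ rest)) (≤-⊕ʳ s rest) (≤-⊕ʳ s (s ⊕ rest)))

    module _ (C : MVSpace ℓ) (hc : IsHC C) (f : ContinuousMap X C) where
      open Limits C hc (fun f)

      extend-fun : Point → Carrier C
      extend-fun k = lim (proj₁ k)

      extend-class : ∀ U → extend-fun (class U) ≡ lim U
      extend-class U = sym (rep-~ U C hc f)

      extend-η : ∀ x → extend-fun (η x) ≡ fun f x
      extend-η x = trans (extend-class (principal x)) (lim-principal x)

      -- Openness in `K` has two halves: on X the extension restricts to `f`, which is continuous,
      -- and semicontinuity is that of limits, transported to classes.
      extension : ContinuousMap K C
      extension = mkContinuous extend-fun λ α αᵒ →
        subst (Open X) (fe _ _ λ x → cong α (sym (extend-η x))) (cont f α αᵒ) ,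
        λ U ε 0<ε → let S , U∋S , near-α = lim-semicontinuous α αᵒ U ε 0<ε in
          S , U∋S , λ V V∋S → subst₂ (λ c d → val (α c) ≤[ ε ] val (α d))
            (sym (extend-class U)) (sym (extend-class V)) (near-α V V∋S)

    -- Distinct points are inequivalent, so their limits differ under some map to a compact
    -- Hausdorff space; separating opens pull back along its extension.
    K-hausdorff : Hausdorff K
    K-hausdorff k k′ k≢k′ = pull-back separating
      where
      Separating : Set (lsuc ℓ)
      Separating = Σ (MVSpace ℓ) λ C → Σ (IsHC C) λ hc → Σ (ContinuousMap X C) λ f →
        extend-fun C hc f k ≢ extend-fun C hc f k′

      separating : Separating
      separating = by-contradiction λ none → k≢k′
        (trans (sym (class-rep k)) (trans (class-cong λ C hc f →
          by-contradiction λ c≢c′ → none (C , hc , f , c≢c′)) (class-rep k′)))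

      pull-back : Separating → ∃[ o ] ∃[ o′ ]
        (OpenK o × OpenK o′ × Is1 (o k) × Is1 (o′ k′) × o ∧̇ o′ ≐ 𝟎)
      pull-back (C , hc , f , c≢c′) =
        let g = extension C hc f
            o , o′ , oᵒ , o′ᵒ , oc≈1 , o′c′≈1 , o∧o′≐0 = proj₂ hc (fun g k) (fun g k′) c≢c′
        in o ∘ fun g , o′ ∘ fun g , cont g o oᵒ , cont g o′ o′ᵒ , oc≈1 , o′c′≈1 ,
          λ x → o∧o′≐0 (fun g x)

    open-positive : ∀ α k → OpenK α → Is1 (α k) →
      ∃[ S ] (proj₁ k ∋ S × ∀ V → V ∋ S → ¬ Is0 (α (class V)))
    open-positive α k (_ , α-sc) αk≈1 =
      let S , U∋S , near-α = α-sc (proj₁ k) ½ (ℚ.positive⁻¹ ½)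
      in S , U∋S , λ V V∋S → near-1⇒¬Is0 (α (class (proj₁ k))) (α (class V))
        (subst (λ k → Is1 (α k)) (sym (class-rep k)) αk≈1) (near-α V V∋S)

    -- η has dense image, and C is Hausdorff.
    extension-unique : (C : MVSpace ℓ) → Hausdorff C → (g h : ContinuousMap K C) →
      (∀ x → fun g (η x) ≡ fun h (η x)) → ∀ k → fun g k ≡ fun h k
    extension-unique C hausdorff g h agree k = by-contradiction λ gk≢hk →
      let o , o′ , oᵒ , o′ᵒ , og≈1 , o′h≈1 , o∧o′≐0 = hausdorff _ _ gk≢hk
          S , U∋S , o-positive = open-positive (o ∘ fun g) k (cont g o oᵒ) og≈1
          T , U∋T , o′-positive = open-positive (o′ ∘ fun h) k (cont h o′ o′ᵒ) o′h≈1
          R , U∋R , split = both (proj₁ k) S T U∋S U∋T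
          -- The principal ultrafilter at x contains R, hence S and T, so both opens are nonzero at
          -- `η x`, where g and h agree.
          x , x∈R = Ultrafilter.inhabited (proj₁ k) R U∋R
          x∈S , x∈T = split (principal x) x∈R
          c = fun g (η x)
      in Sum.[ o-positive (principal x) x∈S
             , subst (λ d → ¬ Is0 (o′ d)) (sym (agree x)) (o′-positive (principal x) x∈T) ]′
           (∧-Is0⁻ (o c) (o′ c) (o∧o′≐0 c))

  universalArrow : ∀ {ℓ} (X : MVSpace ℓ) → UniversalArrow (i ℓ) X
  universalArrow X = record
    { object    = K , K-compact , K-hausdorff
    ; arrow     = unitMap
    ; lift      = λ { {A , hc} f → extension A hc f }
    ; lift-comm = λ { {A , hc} f → extend-η A hc f }
    ; unique    = λ { {A , hc} g h → extension-unique A (proj₂ hc) g h }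
    }
    where open Compactification X

theorem7p4 : (∀ ℓ → ExcludedMiddle ℓ) →
    (∀ a b → Extensionality a b) →
    ∀ (ℓ : Level) → HasLeftAdjoint (i ℓ)
theorem7p4 em fe ℓ = leftAdjoint (i ℓ) (Reflection.universalArrow em fe)
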